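{- Let $\mathbb K$ be a field of characteristic zero, $n$ a positive integer and $r$ an integer with $2<r<n$. Let $E$ be the edge set of the complete graph $K_n$, $N=\#E$, and identify $E$ with $\{1,\ldots,N\}$. Let $M^r_{K_n}$ be the matroid on $E$ whose bases are the edge sets of the forests in $K_n$ with exactly $r$ edges, let $\Phi=\sum_{B}\prod_{b\in B}x_b$ (sum over bases $B$), and let $A=\mathbb K[x_1,\ldots,x_N]/\mathrm{Ann}(\Phi)=\bigoplus_{j=0}^r A_j$. Let $L=x_1+\cdots+x_N$. Then the multiplication map $\times L^{r-2}\colon A_1\to A_{r-1}$ is bijective.
   Context: $\mathrm{Ann}(\Phi)=\{P\in\mathbb K[x_1,\ldots,x_N]: P(\partial/\partial x_1,\ldots,\partial/\partial x_N)\Phi=0\}$, a homogeneous ideal; $A_j$ is the degree-$j$ homogeneous component of the graded quotient algebra $A$ (which is Artinian Gorenstein with $A_j=0$ for $j>r$). The matroid $M^r_{K_n}$ is the truncation to rank $r$ of the graphic matroid of $K_n$. -}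

module Defs where

open import Level using (Level; _⊔_) renaming (suc to lsuc)
open import Algebra.Bundles using (CommutativeRing)
open import Data.Nat as ℕ using (ℕ; zero; suc; _<_; _≤_; _∸_)
open import Data.Fin as Fin using (Fin)
open import Data.Fin.Properties using (_≟_)
open import Data.Vec as Vec using (Vec; lookup)
import Data.Vec.Properties as VecP
open import Data.List as List using (List; []; _∷_; _++_; length; allFin; concatMap)
open import Data.List.Relation.Unary.All using (All)
open import Data.List.Relation.Unary.Unique.Propositional using (Unique)
open import Data.Product using (Σ; _×_; _,_; proj₁; proj₂; ∃; ∃-syntax)
open import Data.Sum using (_⊎_)
open import Data.Unit.Polymorphic using (⊤)
open import Relation.Nullary using (¬_; yes; no)
open import Relation.Nullary.Decidable using (⌊_⌋)
import Data.Nat.Properties as ℕP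
open import Relation.Binary.PropositionalEquality using (_≡_)

record Field (c ℓ : Level) : Set (lsuc (c ⊔ ℓ)) where
  field
    commutativeRing : CommutativeRing c ℓ
  open CommutativeRing commutativeRing public
  field
    1≉0     : ¬ (1# ≈ 0#)
    inverse : ∀ x → ¬ (x ≈ 0#) → ∃[ y ] (x * y ≈ 1#)

module _ {c ℓ : Level} (F : Field c ℓ) where
  open Field F

  fromℕ : ℕ → Carrier
  fromℕ zero    = 0#
  fromℕ (suc n) = 1# + fromℕ n

  CharZero : Set ℓ
  CharZero = ∀ n → ¬ (fromℕ (suc n) ≈ 0#)

-- Polynomials in N variables over F, as finite formal sums of terms
-- c · x^e  (e : Vec ℕ N an exponent vector).  Two polynomials are equal
-- iff all their coefficients agree.

  Poly : ℕ → Set c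
  Poly N = List (Carrier × Vec ℕ N)

  sumF : List Carrier → Carrier
  sumF = List.foldr _+_ 0#

  coeff : ∀ {N} → Poly N → Vec ℕ N → Carrier
  coeff p e = sumF (List.map proj₁
                (List.filter (λ t → VecP.≡-dec ℕ._≟_ (proj₂ t) e) p))

  IsZero : ∀ {N} → Poly N → Set ℓ
  IsZero p = ∀ e → coeff p e ≈ 0#

  _⊕_ : ∀ {N} → Poly N → Poly N → Poly N
  p ⊕ q = p ++ q

  _⊛_ : ∀ {N} → Poly N → Poly N → Poly N
  p ⊛ q = concatMap (λ s → List.map (λ t → (proj₁ s * proj₁ t ,
                                            Vec.zipWith ℕ._+_ (proj₂ s) (proj₂ t))) q) p

  neg : ∀ {N} → Poly N → Poly N
  neg p = List.map (λ t → (- proj₁ t , proj₂ t)) p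

  _⊖_ : ∀ {N} → Poly N → Poly N → Poly N
  p ⊖ q = p ⊕ neg q

  one : ∀ {N} → Poly N
  one = (1# , Vec.replicate _ 0) ∷ []

  _^P_ : ∀ {N} → Poly N → ℕ → Poly N
  p ^P zero  = one
  p ^P suc k = p ⊛ (p ^P k)

  var : ∀ {N} → Fin N → Poly N
  var k = (1# , Vec.updateAt (Vec.replicate _ 0) k (λ _ → 1)) ∷ []

  Lform : ∀ N → Poly N
  Lform N = concatMap var (allFin N)

  Homogeneous : ∀ {N} → ℕ → Poly N → Set c
  Homogeneous j p = All (λ t → Vec.sum (proj₂ t) ≡ j) p

-- Action of P(∂/∂x_1, …, ∂/∂x_N) on a polynomial.
-- ∂^e x^a = (∏_i a_i (a_i - 1) ⋯ (a_i - e_i + 1)) x^{a - e}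

  falling : ℕ → ℕ → ℕ
  falling a zero          = 1
  falling zero (suc k)    = 0
  falling (suc a) (suc k) = suc a ℕ.* falling a k

  dTerm : ∀ {N} → Carrier × Vec ℕ N → Carrier × Vec ℕ N → Carrier × Vec ℕ N
  dTerm (c₁ , e) (c₂ , a) =
    (c₁ * c₂ * fromℕ (Vec.foldr _ ℕ._*_ 1 (Vec.zipWith falling a e)) ,
     Vec.zipWith _∸_ a e)

  applyD : ∀ {N} → Poly N → Poly N → Poly N
  applyD P Φ = concatMap (λ s → List.map (dTerm s) Φ) P

  Ann : ∀ {N} → Poly N → Poly N → Set ℓ
  Ann Φ P = IsZero (applyD P Φ)

  -- equality in A = K[x]/Ann(Φ)
  _≈[_]_ : ∀ {N} → Poly N → Poly N → Poly N → Set ℓ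
  p ≈[ Φ ] q = Ann Φ (p ⊖ q)

-- The complete graph K_n: vertices Fin n, edges {i,j} with i < j,
-- enumerated in a fixed list; E is identified with Fin N, N = #E.

edgesK : ∀ n → List (Fin n × Fin n)
edgesK n = List.filter (λ p → proj₁ p Fin.<? proj₂ p)
             (List.cartesianProduct (allFin n) (allFin n))

numEdges : ℕ → ℕ
numEdges n = length (edgesK n)

edge : ∀ n → Fin (numEdges n) → Fin n × Fin n
edge n k = List.lookup (edgesK n) k

module _ (n : ℕ) (m : Vec ℕ (numEdges n)) where
  InS : Fin (numEdges n) → Set
  InS k = lookup m k ≡ 1

  Adj : Fin n → Fin n → Set
  Adj u v = ∃[ k ] (InS k × (edge n k ≡ (u , v) ⊎ edge n k ≡ (v , u)))

  Walk : List (Fin n) → Set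
  Walk (x ∷ y ∷ zs) = Adj x y × Walk (y ∷ zs)
  Walk _            = ⊤

  Cycle : Set
  Cycle = Σ (Fin n) λ v → Σ (List (Fin n)) λ ws →
            (2 ≤ length ws) × Unique (v ∷ ws) × Walk (v ∷ ws ++ v ∷ [])

  -- m is the 0/1 indicator vector of a forest with exactly r edges,
  -- i.e. of a basis of the truncated graphic matroid M^r_{K_n}
  IsBasisIndicator : ℕ → Set
  IsBasisIndicator r =
    (∀ k → lookup m k ≤ 1) × (Vec.sum m ≡ r) × ¬ Cycle

module _ {c ℓ : Level} (F : Field c ℓ) where
  open Field F

  -- Φ is (as a polynomial) Σ_B ∏_{b∈B} x_b, the sum over the bases of M^r_{K_n}
  IsBasisGenPoly : (n r : ℕ) → Poly F (numEdges n) → Set ℓ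
  IsBasisGenPoly n r Φ = ∀ m →
    (IsBasisIndicator n m r → coeff F Φ m ≈ 1#) ×
    (¬ IsBasisIndicator n m r → coeff F Φ m ≈ 0#)

{-# OPTIONS --safe #-}
module Submission where

-- Writing g for the coefficient function of Φ, the coefficient of P(∂)Φ at x^m
-- is Σ_e P_e g(m + e), because Φ is squarefree.  Hence ×L^k : A₁ → A_{k+1}, with
-- k = r - 2, is given by the matrix M(e,f) counting the edge sequences s of
-- length k for which e, f and s form a forest; it is enough to invert M.
--
-- Classify s by the components of four distinct vertices.  Let t (apart) count
-- the forests s separating all four, and p (merged) those joining exactly one
-- given pair; by symmetry neither depends on the vertices.  Then M(e,f) is
-- t + 3p if e and f share one vertex, t + 4p if they are disjoint, and 0 if
-- e = f.  With B the edge-vertex incidence matrix this says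
--   - M = - (t + 4p) J + p B Bᵀ + (t + 2p) I,
-- an element of the commutative algebra spanned by J, B Bᵀ and I, in which its
-- three eigenvalues are nonzero integers because t + 3p > 0.

open import Defs
open import Level using (Level)
open import Algebra.Bundles using (CommutativeRing)
open import Data.Nat as ℕ using (ℕ; zero; suc; _∸_; _<_; _≤_; z≤n; s≤s)
import Data.Nat.Properties as ℕP
open import Data.Nat.Solver using (module +-*-Solver)
open import Algebra.Properties.CommutativeSemigroup ℕP.+-commutativeSemigroup using () renaming (interchange to +-interchange)
import Algebra.Properties.Semiring.Sum ℕP.+-*-semiring as ℕΣ
open import Data.Fin as Fin using (Fin; zero; suc)
import Data.Fin.Properties as FinP
open import Data.Fin.Permutation as Perm using (Permutation; _⟨$⟩ʳ_; _⟨$⟩ˡ_; _∘ₚ_)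
import Data.Fin.Permutation.Components as PC
open import Data.Vec as Vec using (Vec; lookup)
import Data.Vec.Properties as VecP
open import Data.List as List using (List; []; _∷_; _++_; length; concatMap)
open import Data.List.Membership.Propositional using (_∈_; _∉_)
import Data.List.Membership.Propositional.Properties as ∈P
import Data.List.Membership.Setoid.Properties as ∈SP
open import Data.List.Relation.Unary.Any as Any using (Any; here; there)
import Data.List.Relation.Unary.Any.Properties as AnyP
open import Data.List.Relation.Unary.All as All using (All; []; _∷_)
import Data.List.Relation.Unary.All.Properties as AllP
open import Data.List.Relation.Unary.AllPairs using ([]; _∷_)
open import Data.List.Relation.Unary.Unique.Propositional using (Unique)
import Data.List.Relation.Unary.Unique.Propositional.Properties as UniqueP
open import Data.List.Relation.Binary.Pointwise as Pointwise using (Pointwise; []; _∷_)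
open import Data.Product using (_×_; _,_; proj₁; proj₂; ∃-syntax; swap)
open import Data.Sum using (_⊎_; inj₁; inj₂; [_,_]′)
open import Data.Unit using (⊤; tt)
open import Function using (_∘_; id)
open import Relation.Nullary using (¬_; Dec; yes; no; contradiction)
open import Relation.Nullary.Decidable using (_×-dec_; _⊎-dec_; ¬?; decidable-stable; dec-true; dec-false)
open import Relation.Binary using (tri<; tri≈; tri>)
import Relation.Binary.PropositionalEquality as ≡
open ≡ using (_≡_; _≢_)

-- The four-vertex classification ties the two off-diagonal values of M together: for adjacent edges
-- an auxiliary fourth vertex is brought in, so that both values are combinations of the same `t`
-- and `p`, and they differ by exactly `p`. The count `t` is zero when r = n - 1, which is why
-- positivity rests on t + 3p. Symmetry meets an obstacle: edges are enumerated with increasing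
-- endpoints, an orientation that vertex permutations do not respect. The counts are therefore
-- compared with sums over all ordered pairs, larger by the factor 2^k, on which permutations do
-- act. The eigenvalues come from BᵀB = J + (n - 2) I, which gives B Bᵀ the eigenvalues 2(n - 1), n
-- - 2 and 0. Those of -M are t + 2p on the kernel of Bᵀ, t + np on images under B of vectors of sum
-- zero, and 2(n - 1)p + t + 2p - (t + 4p)N on constants; the last is negative because N is at least
-- n. The inverse is sought in the same algebra, where it is the solution of a triangular system, so
-- eigenvectors are never constructed.

module CompleteGraph where

  open import Data.Nat using (_+_; _*_; _^_)
  open ℕΣ using (sum)
  open import Data.List using (map)
  open ≡ using (refl; sym; trans; cong; cong₂; subst; setoid; module ≡-Reasoning)

  -- Connectivity and forests, by adding the edges of a list one at a time

  Pair : ℕ → Set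
  Pair n = Fin n × Fin n

  private variable
    n : ℕ

  -- A connection through the new edge may be taken to cross it once, in one of two directions. With
  -- walks replaced by this recursion, decidability and invariance under relabelling are immediate
  -- inductions.
  Conn : List (Pair n) → Fin n → Fin n → Set
  Conn []            x y = x ≡ y
  Conn ((u , v) ∷ s) x y = Conn s x y ⊎ (Conn s x u × Conn s v y) ⊎ (Conn s x v × Conn s u y)

  -- Every edge must join two different components of the edges after it. Loops and repeated edges
  -- are thereby excluded as well.
  Forest : List (Pair n) → Set
  Forest []            = ⊤
  Forest ((u , v) ∷ s) = Forest s × ¬ Conn s u v

  conn? : (s : List (Pair n)) (x y : Fin n) → Dec (Conn s x y)
  conn? []            x y = x FinP.≟ y
  conn? ((u , v) ∷ s) x y =
    conn? s x y ⊎-dec ((conn? s x u ×-dec conn? s v y) ⊎-dec (conn? s x v ×-dec conn? s u y))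

  forest? : (s : List (Pair n)) → Dec (Forest s)
  forest? []            = yes tt
  forest? ((u , v) ∷ s) = forest? s ×-dec ¬? (conn? s u v)

  conn-refl : (s : List (Pair n)) {x : Fin n} → Conn s x x
  conn-refl []      = refl
  conn-refl (_ ∷ s) = inj₁ (conn-refl s)

  conn-sym : (s : List (Pair n)) {x y : Fin n} → Conn s x y → Conn s y x
  conn-sym []      p                      = sym p
  conn-sym (_ ∷ s) (inj₁ p)               = inj₁ (conn-sym s p)
  conn-sym (_ ∷ s) (inj₂ (inj₁ (p , q))) = inj₂ (inj₂ (conn-sym s q , conn-sym s p))
  conn-sym (_ ∷ s) (inj₂ (inj₂ (p , q))) = inj₂ (inj₁ (conn-sym s q , conn-sym s p))

  -- If both connections cross the new edge in the same direction, their outer halves suffice; if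
  -- they cross it in opposite directions, the two crossings cancel.
  conn-trans : (s : List (Pair n)) {x y z : Fin n} → Conn s x y → Conn s y z → Conn s x z
  conn-trans []      p q = trans p q
  conn-trans (_ ∷ s) (inj₁ p) (inj₁ q) = inj₁ (conn-trans s p q)
  conn-trans (_ ∷ s) (inj₁ p) (inj₂ (inj₁ (q , q′))) = inj₂ (inj₁ (conn-trans s p q , q′))
  conn-trans (_ ∷ s) (inj₁ p) (inj₂ (inj₂ (q , q′))) = inj₂ (inj₂ (conn-trans s p q , q′))
  conn-trans (_ ∷ s) (inj₂ (inj₁ (p , p′))) (inj₁ q) = inj₂ (inj₁ (p , conn-trans s p′ q))
  conn-trans (_ ∷ s) (inj₂ (inj₂ (p , p′))) (inj₁ q) = inj₂ (inj₂ (p , conn-trans s p′ q))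
  conn-trans (_ ∷ s) (inj₂ (inj₁ (p , _))) (inj₂ (inj₁ (_ , q))) = inj₂ (inj₁ (p , q))
  conn-trans (_ ∷ s) (inj₂ (inj₁ (p , _))) (inj₂ (inj₂ (_ , q))) = inj₁ (conn-trans s p q)
  conn-trans (_ ∷ s) (inj₂ (inj₂ (p , _))) (inj₂ (inj₁ (_ , q))) = inj₁ (conn-trans s p q)
  conn-trans (_ ∷ s) (inj₂ (inj₂ (p , _))) (inj₂ (inj₂ (_ , q))) = inj₂ (inj₂ (p , q))

  conn-edge : {s : List (Pair n)} {u v : Fin n} → (u , v) ∈ s → Conn s u v
  conn-edge {s = _ ∷ s} (here refl) = inj₂ (inj₁ (conn-refl s , conn-refl s))
  conn-edge {s = _ ∷ _} (there i)   = inj₁ (conn-edge i)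

  conn-lift : (s s′ : List (Pair n)) → (∀ {u v} → (u , v) ∈ s → Conn s′ u v) →
              ∀ {x y} → Conn s x y → Conn s′ x y
  conn-lift []      s′ _ refl     = conn-refl s′
  conn-lift (_ ∷ s) s′ f (inj₁ p) = conn-lift s s′ (f ∘ there) p
  conn-lift (_ ∷ s) s′ f (inj₂ (inj₁ (p , q))) =
    conn-trans s′ (conn-lift s s′ (f ∘ there) p)
      (conn-trans s′ (f (here refl)) (conn-lift s s′ (f ∘ there) q))
  conn-lift (_ ∷ s) s′ f (inj₂ (inj₂ (p , q))) =
    conn-trans s′ (conn-lift s s′ (f ∘ there) p)
      (conn-trans s′ (conn-sym s′ (f (here refl))) (conn-lift s s′ (f ∘ there) q))

  conn-mono : (s s′ : List (Pair n)) → (∀ {e} → e ∈ s → e ∈ s′) →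
              ∀ {x y} → Conn s x y → Conn s′ x y
  conn-mono s s′ s⊆s′ = conn-lift s s′ (conn-edge ∘ s⊆s′)

  -- The connections in `s` that would close a cycle through both edges are the same, up to
  -- symmetry, whichever of the two is added last.
  forest-swap : (e f : Pair n) (s : List (Pair n)) → Forest (e ∷ f ∷ s) → Forest (f ∷ e ∷ s)
  forest-swap (e₁ , e₂) (f₁ , f₂) s ((Fs , ¬f) , ¬e) = (Fs , λ p → ¬e (inj₁ p)) , λ where
    (inj₁ p)              → ¬f p
    (inj₂ (inj₁ (p , q))) → ¬e (inj₂ (inj₁ (conn-sym s p , conn-sym s q)))
    (inj₂ (inj₂ (p , q))) → ¬e (inj₂ (inj₂ (q , p)))

  -- Agreement with acyclicity

  unit : ∀ {N} → Fin N → Vec ℕ N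
  unit k = Vec.updateAt (Vec.replicate _ 0) k (λ _ → 1)

  -- The exponent vector of the product of the variables in the list. Powers of the linear form
  -- expand over lists, while coefficients are indexed by vectors; this map links the two.
  tally : ∀ {N} → List (Fin N) → Vec ℕ N
  tally []      = Vec.replicate _ 0
  tally (k ∷ s) = Vec.zipWith _+_ (unit k) (tally s)

  lookup-unit : ∀ {N} (k : Fin N) → lookup (unit k) k ≡ 1
  lookup-unit k = VecP.lookup∘updateAt k (Vec.replicate _ 0)

  lookup-unit-≢ : ∀ {N} {j k : Fin N} → j ≢ k → lookup (unit k) j ≡ 0
  lookup-unit-≢ {j = j} {k} j≢k =
    trans (VecP.lookup∘updateAt′ j k j≢k (Vec.replicate _ 0)) (VecP.lookup-replicate j 0)

  sum-+ : ∀ {N} (a b : Vec ℕ N) → Vec.sum (Vec.zipWith _+_ a b) ≡ Vec.sum a + Vec.sum b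
  sum-+ Vec.[]      Vec.[]      = refl
  sum-+ (x Vec.∷ a) (y Vec.∷ b) rewrite sum-+ a b =
    +-interchange x y (Vec.sum a) (Vec.sum b)

  sum-zeros : ∀ N → Vec.sum (Vec.replicate N 0) ≡ 0
  sum-zeros zero    = refl
  sum-zeros (suc N) = sum-zeros N

  sum-unit : ∀ {N} (k : Fin N) → Vec.sum (unit k) ≡ 1
  sum-unit {suc N} zero    = cong suc (sum-zeros N)
  sum-unit {suc N} (suc k) = sum-unit k

  sum-tally : ∀ {N} (s : List (Fin N)) → Vec.sum (tally s) ≡ length s
  sum-tally {N} []  = sum-zeros N
  sum-tally (k ∷ s) = trans (sum-+ (unit k) (tally s)) (cong₂ _+_ (sum-unit k) (sum-tally s))

  lookup-tally : ∀ {N} (k : Fin N) s j →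
                 lookup (tally (k ∷ s)) j ≡ lookup (unit k) j + lookup (tally s) j
  lookup-tally k s j = VecP.lookup-zipWith _+_ j (unit k) (tally s)

  tally-here : ∀ {N} (k : Fin N) s → lookup (tally (k ∷ s)) k ≡ suc (lookup (tally s) k)
  tally-here k s = trans (lookup-tally k s k) (cong (_+ lookup (tally s) k) (lookup-unit k))

  tally-there : ∀ {N} {j k : Fin N} s → j ≢ k → lookup (tally (k ∷ s)) j ≡ lookup (tally s) j
  tally-there {j = j} {k} s j≢k =
    trans (lookup-tally k s j) (cong (_+ lookup (tally s) j) (lookup-unit-≢ j≢k))

  tally-⊆ : ∀ {N} (k : Fin N) s j → lookup (tally s) j ≤ lookup (tally (k ∷ s)) j
  tally-⊆ k s j = subst (lookup (tally s) j ≤_) (sym (lookup-tally k s j)) (ℕP.m≤n+m _ _)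

  tally-∈ : ∀ {N} {j : Fin N} s → j ∈ s → 1 ≤ lookup (tally s) j
  tally-∈ (k ∷ s) (here refl) = subst (1 ≤_) (sym (tally-here k s)) (s≤s z≤n)
  tally-∈ (k ∷ s) (there i)   = ℕP.≤-trans (tally-∈ s i) (tally-⊆ k s _)

  ∈-tally : ∀ {N} {j : Fin N} s → 1 ≤ lookup (tally s) j → j ∈ s
  ∈-tally {j = j} [] 1≤ = contradiction (subst (1 ≤_) (VecP.lookup-replicate j 0) 1≤) λ ()
  ∈-tally {j = j} (k ∷ s) 1≤ with j FinP.≟ k
  ... | yes refl = here refl
  ... | no j≢k   = there (∈-tally s (subst (1 ≤_) (tally-there s j≢k) 1≤))

  lookup-injective : {A : Set} {xs : List A} → Unique xs → ∀ i j →
                     List.lookup xs i ≡ List.lookup xs j → i ≡ j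
  lookup-injective {xs = _ ∷ xs} _ zero zero _ = refl
  lookup-injective {xs = _ ∷ xs} u zero (suc j) refl =
    contradiction (∈P.∈-lookup {xs = xs} j) (UniqueP.Unique[x∷xs]⇒x∉xs u)
  lookup-injective {xs = _ ∷ xs} u (suc i) zero refl =
    contradiction (∈P.∈-lookup {xs = xs} i) (UniqueP.Unique[x∷xs]⇒x∉xs u)
  lookup-injective {xs = _ ∷ xs} (_ ∷ u) (suc i) (suc j) eq = cong suc (lookup-injective u i j eq)

  edge-injective : ∀ n {j k} → edge n j ≡ edge n k → j ≡ k
  edge-injective n = lookup-injective
    (UniqueP.filter⁺ (λ p → proj₁ p Fin.<? proj₂ p)
      (UniqueP.cartesianProduct⁺ (UniqueP.allFin⁺ n) (UniqueP.allFin⁺ n))) _ _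

  edge-< : ∀ n k → proj₁ (edge n k) Fin.< proj₂ (edge n k)
  edge-< n k = All.lookup
    (AllP.all-filter (λ p → proj₁ p Fin.<? proj₂ p) (List.cartesianProduct (List.allFin n) (List.allFin n)))
    (∈P.∈-lookup k)

  edge-≢ : ∀ n k → proj₁ (edge n k) ≢ proj₂ (edge n k)
  edge-≢ n k = FinP.<⇒≢ (edge-< n k)

  Joins : ∀ n → Fin (numEdges n) → Fin n → Fin n → Set
  Joins n k u v = edge n k ≡ (u , v) ⊎ edge n k ≡ (v , u)

  joins-sym : ∀ {k u v} → Joins n k u v → Joins n k v u
  joins-sym = [ inj₂ , inj₁ ]′

  -- Edges are stored with increasing endpoints, so the same two vertices cannot occur in both
  -- orientations, and in one orientation they determine the index.
  joins-injective : ∀ {j k u v} → Joins n j u v → Joins n k u v → j ≡ k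
  joins-injective {n} (inj₁ p) (inj₁ q) = edge-injective n (trans p (sym q))
  joins-injective {n} (inj₂ p) (inj₂ q) = edge-injective n (trans p (sym q))
  joins-injective {n} {j} {k} (inj₁ p) (inj₂ q) = contradiction
    (subst (λ e → proj₁ e Fin.< proj₂ e) p (edge-< n j))
    (FinP.<-asym (subst (λ e → proj₁ e Fin.< proj₂ e) q (edge-< n k)))
  joins-injective {n} {j} {k} (inj₂ p) (inj₁ q) = contradiction
    (subst (λ e → proj₁ e Fin.< proj₂ e) p (edge-< n j))
    (FinP.<-asym (subst (λ e → proj₁ e Fin.< proj₂ e) q (edge-< n k)))

  joins-conn : ∀ {k u v} (s : List (Fin (numEdges n))) → k ∈ s → Joins n k u v →
               Conn (map (edge n) s) u v
  joins-conn {n} s k∈s (inj₁ p) = conn-edge (subst (_∈ map (edge n) s) p (∈P.∈-map⁺ (edge n) k∈s))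
  joins-conn {n} s k∈s (inj₂ p) = conn-sym (map (edge n) s)
    (conn-edge (subst (_∈ map (edge n) s) p (∈P.∈-map⁺ (edge n) k∈s)))

  -- A second occurrence of an edge would find its endpoints already connected.
  forest-tally-≤1 : ∀ n (s : List (Fin (numEdges n))) → Forest (map (edge n) s) →
                    ∀ j → lookup (tally s) j ≤ 1
  forest-tally-≤1 n []      _        j = subst (_≤ 1) (sym (VecP.lookup-replicate j 0)) z≤n
  forest-tally-≤1 n (k ∷ s) (Fs , ¬k) j with j FinP.≟ k
  ... | no j≢k = subst (_≤ 1) (sym (tally-there s j≢k)) (forest-tally-≤1 n s Fs j)
  ... | yes refl with lookup (tally s) j in eq
  ...   | zero  = ℕP.≤-reflexive (trans (tally-here j s) (cong suc eq))
  ...   | suc _ = contradiction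
                    (joins-conn s (∈-tally s (subst (1 ≤_) (sym eq) (s≤s z≤n))) (inj₁ refl)) ¬k

  -- Repeated swaps bring `k` to the front. The result is described by inclusions: walks only need
  -- every edge other than `k` to survive in `s′`, and the induction only needs that no new edge
  -- appears.
  forest-extract : ∀ n {k} (s : List (Fin (numEdges n))) → k ∈ s → Forest (map (edge n) s) →
    ∃[ s′ ] (Forest (map (edge n) (k ∷ s′)) × (∀ {j} → j ∈ s → j ≢ k → j ∈ s′)
             × (∀ {j} → j ∈ k ∷ s′ → j ∈ s))
  forest-extract n (k ∷ s) (here refl) F =
    s , F , (λ { (here p) j≢k → contradiction p j≢k ; (there i) _ → i }) , id
  forest-extract n {k} (l ∷ s) (there k∈s) (F , ¬l) with forest-extract n s k∈s F
  ... | s′ , F′ , ⊆₁ , ⊆₂ = l ∷ s′ ,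
    forest-swap (edge n l) (edge n k) (map (edge n) s′)
      (F′ , λ p → ¬l (conn-mono (map (edge n) (k ∷ s′)) (map (edge n) s) map-⊆ p)) ,
    (λ { (here p) _ → here p ; (there i) j≢k → there (⊆₁ i j≢k) }) ,
    (λ { (here p) → there (⊆₂ (here p)) ; (there (here p)) → here p
       ; (there (there i)) → there (⊆₂ (there i)) })
    where
    map-⊆ : ∀ {e} → e ∈ map (edge n) (k ∷ s′) → e ∈ map (edge n) s
    map-⊆ e∈ with ∈P.∈-map⁻ (edge n) e∈
    ... | j , j∈ , refl = ∈P.∈-map⁺ (edge n) (⊆₂ j∈)

  module _ (n : ℕ) (s s′ : List (Fin (numEdges n))) (v w : Fin n)
           (keep : ∀ {j x y} → j ∈ s → Joins n j x y → ¬ Joins n j v w → j ∈ s′) where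

    private
      step : ∀ {x y} → Adj n (tally s) x y → (∀ {j} → Joins n j x y → ¬ Joins n j v w) →
             Conn (map (edge n) s′) x y
      step (j , j∈S , p) ≢vw = joins-conn s′ (keep (∈-tally s (ℕP.≤-reflexive (sym j∈S))) p (≢vw p)) p

      endpoints : ∀ {j a b c d} → Joins n j a b → Joins n j c d → a ≡ c × b ≡ d ⊎ a ≡ d × b ≡ c
      endpoints (inj₁ p) (inj₁ q) with trans (sym p) q
      ... | refl = inj₁ (refl , refl)
      endpoints (inj₁ p) (inj₂ q) with trans (sym p) q
      ... | refl = inj₂ (refl , refl)
      endpoints (inj₂ p) (inj₁ q) with trans (sym p) q
      ... | refl = inj₂ (refl , refl)
      endpoints (inj₂ p) (inj₂ q) with trans (sym p) q
      ... | refl = inj₁ (refl , refl)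

    walk-inner : ∀ {x y} → Adj n (tally s) x y → x ≢ v → y ≢ v → Conn (map (edge n) s′) x y
    walk-inner a x≢v y≢v = step a λ p q → [ x≢v ∘ proj₁ , y≢v ∘ proj₂ ]′ (endpoints p q)

    -- Only the last step of the walk enters `v`, and it starts at a vertex other than `w`; hence no
    -- step is the edge joining `v` and `w`, and all of them survive in `s′`.
    walk-conn : ∀ x ws → All (_≢ v) (x ∷ ws) → All (_≢ w) (x ∷ ws) →
                Walk n (tally s) (x ∷ ws ++ v ∷ []) → Conn (map (edge n) s′) x v
    walk-conn x [] (x≢v ∷ _) (x≢w ∷ _) (a , _) =
      step a λ p q → [ x≢v ∘ proj₁ , x≢w ∘ proj₁ ]′ (endpoints p q)
    walk-conn x (y ∷ ws) (x≢v ∷ y≢v ∷ ≢v) (_ ∷ ≢w) (a , walk) =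
      conn-trans (map (edge n) s′) (walk-inner a x≢v y≢v) (walk-conn y ws (y≢v ∷ ≢v) ≢w walk)

  -- The first edge of a cycle can be moved to the front of s; the rest of the
  -- cycle then joins its endpoints without using it.
  forest-acyclic : ∀ n (s : List (Fin (numEdges n))) → Forest (map (edge n) s) → ¬ Cycle n (tally s)
  forest-acyclic n s F (v , _ ∷ [] , s≤s () , _)
  forest-acyclic n s F (v , w ∷ x ∷ ws , _ , (v≢w ∷ v≢x ∷ v≢) ∷ (w≢x ∷ w≢) ∷ _ , (k , k∈S , p) , (a , walk))
    with forest-extract n s (∈-tally s (ℕP.≤-reflexive (sym k∈S))) F
  ... | s′ , (_ , ¬k) , keep , _ = ¬vw (conn-sym es (conn-trans es w~x x~v))
    where
    es = map (edge n) s′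
    keep′ : ∀ {j x y} → j ∈ s → Joins n j x y → ¬ Joins n j v w → j ∈ s′
    keep′ j∈s _ ¬vw = keep j∈s λ { refl → ¬vw p }
    ≢-flip : ∀ {a : Fin n} {xs} → All (a ≢_) xs → All (_≢ a) xs
    ≢-flip = All.map (_∘ sym)
    w~x : Conn es w x
    w~x = walk-inner n s s′ v w keep′ a (v≢w ∘ sym) (v≢x ∘ sym)
    x~v : Conn es x v
    x~v = walk-conn n s s′ v w keep′ x ws (≢-flip (v≢x ∷ v≢)) (≢-flip (w≢x ∷ w≢)) walk
    ¬vw : ¬ Conn es v w
    ¬vw c = [ (λ eq → ¬k (subst (λ e → Conn es (proj₁ e) (proj₂ e)) (sym eq) c))
            , (λ eq → ¬k (subst (λ e → Conn es (proj₁ e) (proj₂ e)) (sym eq) (conn-sym es c))) ]′ p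

  forest⇒basis : ∀ n r (s : List (Fin (numEdges n))) → length s ≡ r → Forest (map (edge n) s) →
                 IsBasisIndicator n (tally s) r
  forest⇒basis n r s len F =
    forest-tally-≤1 n s F , trans (sum-tally s) len , forest-acyclic n s F

  -- Both ends are part of the type, which makes concatenation direct. The list holds the vertices
  -- after the start, so a trail closed by one more edge has the shape required by `Cycle`.
  data Trail (n : ℕ) (m : Vec ℕ (numEdges n)) : Fin n → List (Fin n) → Fin n → Set where
    stop : ∀ {x} → Trail n m x [] x
    step : ∀ {x y z ws} → Adj n m x y → Trail n m y ws z → Trail n m x (y ∷ ws) z

  module _ {n : ℕ} {m : Vec ℕ (numEdges n)} where

    trail-++ : ∀ {x y u v ws ws′} → Trail n m x ws u → Adj n m u v → Trail n m v ws′ y →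
               Trail n m x (ws ++ v ∷ ws′) y
    trail-++ stop       b t′ = step b t′
    trail-++ (step a t) b t′ = step a (trail-++ t b t′)

    trail-walk : ∀ {x y z ws} → Trail n m x ws y → Adj n m y z → Walk n m (x ∷ ws ++ z ∷ [])
    trail-walk stop       b = b , _
    trail-walk (step a t) b = a , trail-walk t b

    adj-sym : ∀ {x y} → Adj n m x y → Adj n m y x
    adj-sym (k , k∈S , p) = k , k∈S , joins-sym p

  adj-mono : ∀ {n m m′} → (∀ k → lookup m k ≡ 1 → lookup m′ k ≡ 1) →
             ∀ {x y} → Adj n m x y → Adj n m′ x y
  adj-mono f (k , k∈S , p) = k , f k k∈S , p

  trail-mono : ∀ {n m m′} → (∀ k → lookup m k ≡ 1 → lookup m′ k ≡ 1) →
               ∀ {x ws y} → Trail n m x ws y → Trail n m′ x ws y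
  trail-mono f stop = stop
  trail-mono {m = m} {m′} f (step a t) = step (adj-mono {m = m} {m′} f a) (trail-mono f t)

  -- The last component keeps the whole path inside the component of `x`. It is what makes paths in
  -- different components disjoint when they are concatenated.
  SimplePath : (n : ℕ) → List (Fin (numEdges n)) → Fin n → Fin n → Set
  SimplePath n s x y = ∃[ ws ] (Trail n (tally s) x ws y × Unique (x ∷ ws)
                                × All (Conn (map (edge n) s) x) (x ∷ ws))

  -- When the connection crosses `k`, the two halves lie in different components of `s` because `k`
  -- closes no cycle there. They share no vertex, so their concatenation is again simple.
  forest-path : ∀ n (s : List (Fin (numEdges n))) → Forest (map (edge n) s) →
                ∀ {x y} → Conn (map (edge n) s) x y → SimplePath n s x y
  forest-path n [] _ refl = [] , stop , [] ∷ [] , refl ∷ []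
  forest-path n (k ∷ s) F@(Fs , ¬k) {x} {y} = λ where
      (inj₁ p) → weaken (forest-path n s Fs p)
      (inj₂ (inj₁ (p , q))) → join ¬k k-adj p (forest-path n s Fs p) (forest-path n s Fs q)
      (inj₂ (inj₂ (p , q))) → join (¬k ∘ conn-sym es) (adj-sym {m = tally (k ∷ s)} k-adj) p
                                (forest-path n s Fs p) (forest-path n s Fs q)
    where
    es = map (edge n) s
    mono : ∀ j → lookup (tally s) j ≡ 1 → lookup (tally (k ∷ s)) j ≡ 1
    mono j eq = ℕP.≤-antisym (forest-tally-≤1 n (k ∷ s) F j)
      (ℕP.≤-trans (ℕP.≤-reflexive (sym eq)) (tally-⊆ k s j))
    k-adj : Adj n (tally (k ∷ s)) (proj₁ (edge n k)) (proj₂ (edge n k))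
    k-adj = k , ℕP.≤-antisym (forest-tally-≤1 n (k ∷ s) F k) (tally-∈ (k ∷ s) (here refl)) , inj₁ refl
    weaken : SimplePath n s x y → SimplePath n (k ∷ s) x y
    weaken (ws , t , u , c) = ws , trail-mono mono t , u , All.map inj₁ c
    adj-conn : ∀ {u v} → Adj n (tally (k ∷ s)) u v → Conn (map (edge n) (k ∷ s)) u v
    adj-conn (j , j∈S , p) = joins-conn (k ∷ s) (∈-tally (k ∷ s) (ℕP.≤-reflexive (sym j∈S))) p
    join : ∀ {u v} → ¬ Conn es u v → Adj n (tally (k ∷ s)) u v → Conn es x u →
           SimplePath n s x u → SimplePath n s v y → SimplePath n (k ∷ s) x y
    join {u} {v} ¬uv a x~u (ws , t , U , c) (ws′ , t′ , U′ , c′) =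
      ws ++ v ∷ ws′ , trail-++ (trail-mono mono t) a (trail-mono mono t′) ,
      UniqueP.++⁺ U U′ disjoint ,
      AllP.++⁺ (All.map inj₁ c) (All.map (λ q → conn-trans (map (edge n) (k ∷ s)) (inj₁ x~u)
        (conn-trans (map (edge n) (k ∷ s)) (adj-conn a) (inj₁ q))) c′)
      where
      disjoint : ∀ {z} → ¬ (z ∈ x ∷ ws × z ∈ v ∷ ws′)
      disjoint (i , i′) = ¬uv (conn-trans es (conn-sym es x~u)
        (conn-trans es (All.lookup c i) (conn-sym es (All.lookup c′ i′))))

  -- If the endpoints of `k` were connected by the remaining edges, these would contain a simple
  -- path between them, and `k` would close it to a cycle.
  basis⇒forest : ∀ n (s : List (Fin (numEdges n))) → (∀ j → lookup (tally s) j ≤ 1) →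
                 ¬ Cycle n (tally s) → Forest (map (edge n) s)
  basis⇒forest n []      _  _    = tt
  basis⇒forest n (k ∷ s) ≤1 ¬cyc = Fs , ¬k
    where
    mono : ∀ j → lookup (tally s) j ≡ 1 → lookup (tally (k ∷ s)) j ≡ 1
    mono j eq = ℕP.≤-antisym (≤1 j) (ℕP.≤-trans (ℕP.≤-reflexive (sym eq)) (tally-⊆ k s j))
    walk-mono : ∀ xs → Walk n (tally s) xs → Walk n (tally (k ∷ s)) xs
    walk-mono []           _       = _
    walk-mono (_ ∷ [])     _       = _
    walk-mono (_ ∷ y ∷ xs) (a , w) = adj-mono {m = tally s} {tally (k ∷ s)} mono a , walk-mono (y ∷ xs) w
    Fs : Forest (map (edge n) s)
    Fs = basis⇒forest n s (λ j → ℕP.≤-trans (tally-⊆ k s j) (≤1 j))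
           λ { (v , ws , len , u , w) → ¬cyc (v , ws , len , u , walk-mono (v ∷ ws ++ v ∷ []) w) }
    k∉s : ¬ lookup (tally s) k ≡ 1
    k∉s eq = contradiction (subst (_≤ 1) (trans (tally-here k s) (cong suc eq)) (≤1 k)) λ { (s≤s ()) }
    back : Adj n (tally (k ∷ s)) (proj₂ (edge n k)) (proj₁ (edge n k))
    back = k , ℕP.≤-antisym (≤1 k) (tally-∈ (k ∷ s) (here refl)) , inj₂ refl
    close : ∀ {u v} → Joins n k u v → u ≢ v → Adj n (tally (k ∷ s)) v u → ¬ SimplePath n s u v
    close _ u≢v _ ([] , stop , _) = u≢v refl
    -- `Cycle` asks for at least three vertices, so a path of a single edge must be excluded
    -- separately: that edge would be `k` again, against the bound on multiplicities.
    close k-uv _ _ (_ ∷ [] , step (j , j∈S , p) stop , _) with joins-injective {n} k-uv p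
    ... | refl = k∉s j∈S
    close {u} _ _ b (x ∷ y ∷ ws , t , U , _) =
      ¬cyc (u , x ∷ y ∷ ws , s≤s (s≤s z≤n) , U , trail-walk (trail-mono mono t) b)
    ¬k : ¬ Conn (map (edge n) s) (proj₁ (edge n k)) (proj₂ (edge n k))
    ¬k c = close (inj₁ refl) (edge-≢ n k) back (forest-path n s Fs c)

  -- Indicators of decidable propositions

  ind : ∀ {a} {P : Set a} → Dec P → ℕ
  ind (yes _) = 1
  ind (no _)  = 0

  ind-yes : ∀ {a} {P : Set a} (d : Dec P) → P → ind d ≡ 1
  ind-yes (yes _) _ = refl
  ind-yes (no ¬p) p = contradiction p ¬p

  ind-no : ∀ {a} {P : Set a} (d : Dec P) → ¬ P → ind d ≡ 0
  ind-no (yes p) ¬p = contradiction p ¬p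
  ind-no (no _)  _  = refl

  ind-cong : ∀ {a b} {P : Set a} {Q : Set b} (d : Dec P) (d′ : Dec Q) → (P → Q) → (Q → P) → ind d ≡ ind d′
  ind-cong (yes p) d′ f _ = sym (ind-yes d′ (f p))
  ind-cong (no ¬p) d′ _ g = sym (ind-no d′ (¬p ∘ g))

  δ : Fin n → Fin n → ℕ
  δ i j = ind (i FinP.≟ j)

  δ-refl : (i : Fin n) → δ i i ≡ 1
  δ-refl i = ind-yes (i FinP.≟ i) refl

  δ-≢ : {i j : Fin n} → i ≢ j → δ i j ≡ 0
  δ-≢ {i = i} {j} = ind-no (i FinP.≟ j)

  -- Sums over the edges of K_n

  sum-0 : ∀ n → sum {n} (λ _ → 0) ≡ 0
  sum-0 = ℕΣ.sum-replicate-zero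

  sum-const : ∀ n c → sum {n} (λ _ → c) ≡ n * c
  sum-const zero    c = refl
  sum-const (suc n) c = cong (c +_) (sum-const n c)

  sum-δ : (i : Fin n) (f : Fin n → ℕ) → sum (λ u → δ u i * f u) ≡ f i
  sum-δ {suc n} zero f = trans (cong₂ _+_ (ℕP.+-identityʳ (f zero)) (sum-0 n)) (ℕP.+-identityʳ (f zero))
  sum-δ {suc n} (suc i) f = trans (ℕΣ.sum-cong-≗ (λ u → cong (_* f (suc u)) (δ-suc u))) (sum-δ i (f ∘ suc))
    where
    δ-suc : ∀ u → δ (suc u) (suc i) ≡ δ u i
    δ-suc u = ind-cong (suc u FinP.≟ suc i) (u FinP.≟ i) FinP.suc-injective (cong suc)

  term≤sum : ∀ {n} (f : Fin n → ℕ) i → f i ≤ sum f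
  term≤sum f zero    = ℕP.m≤m+n _ _
  term≤sum f (suc i) = ℕP.≤-trans (term≤sum (f ∘ suc) i) (ℕP.m≤n+m _ _)

  sumOver : {A : Set} → (A → ℕ) → List A → ℕ
  sumOver f = List.foldr (λ x → f x +_) 0

  sum-lookup : {A : Set} (f : A → ℕ) (xs : List A) → sum (λ i → f (List.lookup xs i)) ≡ sumOver f xs
  sum-lookup f []       = refl
  sum-lookup f (x ∷ xs) = cong (f x +_) (sum-lookup f xs)

  sumOver-tabulate : {A : Set} (f : A → ℕ) (h : Fin n → A) → sumOver f (List.tabulate h) ≡ sum (f ∘ h)
  sumOver-tabulate {zero}  f h = refl
  sumOver-tabulate {suc n} f h = cong (f (h zero) +_) (sumOver-tabulate f (h ∘ suc))

  sumOver-filter : {A : Set} {P : A → Set} (P? : ∀ x → Dec (P x)) (f : A → ℕ) (xs : List A) →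
                   sumOver f (List.filter P? xs) ≡ sumOver (λ x → ind (P? x) * f x) xs
  sumOver-filter P? f [] = refl
  sumOver-filter P? f (x ∷ xs) with P? x
  ... | yes _ = cong₂ _+_ (sym (ℕP.+-identityʳ (f x))) (sumOver-filter P? f xs)
  ... | no _  = sumOver-filter P? f xs

  sumOver-++ : {A : Set} (f : A → ℕ) (xs ys : List A) → sumOver f (xs ++ ys) ≡ sumOver f xs + sumOver f ys
  sumOver-++ f []       ys = refl
  sumOver-++ f (x ∷ xs) ys = trans (cong (f x +_) (sumOver-++ f xs ys)) (sym (ℕP.+-assoc (f x) _ _))

  sumOver-map : {A B : Set} (f : B → ℕ) (h : A → B) (xs : List A) → sumOver f (map h xs) ≡ sumOver (f ∘ h) xs
  sumOver-map f h []       = refl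
  sumOver-map f h (x ∷ xs) = cong (f (h x) +_) (sumOver-map f h xs)

  sumOver-× : {A B : Set} (f : A × B → ℕ) (xs : List A) (ys : List B) →
              sumOver f (List.cartesianProduct xs ys) ≡ sumOver (λ x → sumOver (λ y → f (x , y)) ys) xs
  sumOver-× f []       ys = refl
  sumOver-× f (x ∷ xs) ys = trans (sumOver-++ f (map (x ,_) ys) _)
    (cong₂ _+_ (sumOver-map f (x ,_) ys) (sumOver-× f xs ys))

  sum-edge : ∀ n (f : Pair n → ℕ) →
             sum (f ∘ edge n) ≡ sum (λ u → sum (λ v → ind (u Fin.<? v) * f (u , v)))
  sum-edge n f = begin
    sum (f ∘ edge n)                       ≡⟨ sum-lookup f (edgesK n) ⟩
    sumOver f (edgesK n)                   ≡⟨ sumOver-filter (λ p → proj₁ p Fin.<? proj₂ p) f (List.cartesianProduct (List.allFin n) (List.allFin n)) ⟩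
    sumOver f′ (List.cartesianProduct (List.allFin n) (List.allFin n))
                                           ≡⟨ sumOver-× f′ (List.allFin n) (List.allFin n) ⟩
    sumOver (λ u → sumOver (λ v → f′ (u , v)) (List.allFin n)) (List.allFin n)
                                           ≡⟨ sumOver-tabulate (λ u → sumOver (λ v → f′ (u , v)) (List.allFin n)) id ⟩
    sum (λ u → sumOver (λ v → f′ (u , v)) (List.allFin n))
                                           ≡⟨ ℕΣ.sum-cong-≗ (λ u → sumOver-tabulate (λ v → f′ (u , v)) id) ⟩
    sum (λ u → sum (λ v → f′ (u , v)))     ∎
    where
    open ≡-Reasoning
    f′ : Pair n → ℕ
    f′ p = ind (proj₁ p Fin.<? proj₂ p) * f p

  -- An ordered pair is increasing, decreasing or diagonal, and symmetry of `f` makes the first two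
  -- contributions equal. This replaces the restriction to increasing pairs by full double sums.
  sum-pairs : ∀ n (f : Pair n → ℕ) → (∀ u v → f (u , v) ≡ f (v , u)) →
              sum (λ u → sum (λ v → f (u , v))) ≡ 2 * sum (f ∘ edge n) + sum (λ u → f (u , u))
  sum-pairs n f f-sym = sym (begin
    2 * sum (f ∘ edge n) + diag  ≡⟨ cong (λ x → 2 * x + diag) (sum-edge n f) ⟩
    2 * S + diag                 ≡⟨ cong (λ x → S + x + diag) (trans (ℕP.+-identityʳ S) (ℕΣ.∑-comm up)) ⟩
    S + sum (λ u → sum (λ v → up v u)) + diag
      ≡⟨ cong₂ _+_ (sym (ℕΣ.∑-distrib-+ (λ u → sum (up u)) _)) (ℕΣ.sum-cong-≗ (λ u → sym (sum-δ u (λ v → f (u , v))))) ⟩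
    sum (λ u → sum (up u) + sum (λ v → up v u)) + sum (λ u → sum (λ v → δ v u * f (u , v)))
      ≡⟨ sym (ℕΣ.∑-distrib-+ (λ u → sum (up u) + sum (λ v → up v u)) _) ⟩
    sum (λ u → sum (up u) + sum (λ v → up v u) + sum (λ v → δ v u * f (u , v)))
      ≡⟨ ℕΣ.sum-cong-≗ (λ u → trans (cong (_+ sum (λ v → δ v u * f (u , v))) (sym (ℕΣ.∑-distrib-+ (up u) (λ v → up v u))))
           (sym (ℕΣ.∑-distrib-+ (λ v → up u v + up v u) (λ v → δ v u * f (u , v))))) ⟩
    sum (λ u → sum (λ v → up u v + up v u + δ v u * f (u , v)))
      ≡⟨ ℕΣ.sum-cong-≗ (λ u → ℕΣ.sum-cong-≗ (trichotomy u)) ⟩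
    sum (λ u → sum (λ v → f (u , v))) ∎)
    where
    open ≡-Reasoning
    up : Fin n → Fin n → ℕ
    up u v = ind (u Fin.<? v) * f (u , v)
    S    = sum (λ u → sum (up u))
    diag = sum (λ u → f (u , u))
    trichotomy : ∀ u v → up u v + up v u + δ v u * f (u , v) ≡ f (u , v)
    trichotomy u v with FinP.<-cmp u v
    ... | tri< u<v u≢v v≮u rewrite ind-yes (u Fin.<? v) u<v | ind-no (v Fin.<? u) v≮u | δ-≢ (u≢v ∘ sym) =
      trans (ℕP.+-identityʳ _) (trans (ℕP.+-identityʳ _) (ℕP.+-identityʳ _))
    ... | tri≈ u≮v refl _ rewrite ind-no (u Fin.<? u) u≮v | δ-refl u = ℕP.+-identityʳ _
    ... | tri> u≮v u≢v v<u rewrite ind-no (u Fin.<? v) u≮v | ind-yes (v Fin.<? u) v<u | δ-≢ (u≢v ∘ sym) =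
      trans (ℕP.+-identityʳ _) (trans (ℕP.+-identityʳ _) (f-sym v u))

  -- A row of the incidence matrix B. A loop counts twice, which is the source of the diagonal
  -- corrections in `degree` and `codegree`.
  inc : Pair n → Fin n → ℕ
  inc (u , v) i = δ u i + δ v i

  sum-δ₁ : (i : Fin n) → sum (λ u → δ u i) ≡ 1
  sum-δ₁ i = trans (ℕΣ.sum-cong-≗ (λ u → sym (ℕP.*-identityʳ (δ u i)))) (sum-δ i (λ _ → 1))

  sum-scale : ∀ {n} c (f : Fin n → ℕ) → sum (λ u → c * f u) ≡ c * sum f
  sum-scale c f = sym (ℕΣ.*-distribˡ-sum c f)

  inc-sum : (e : Pair n) → sum (inc e) ≡ 2
  inc-sum (u , v) = trans (ℕΣ.∑-distrib-+ (δ u) (δ v)) (cong₂ _+_ (row u) (row v))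
    where
    row : ∀ u → sum (δ u) ≡ 1
    row u = trans (ℕΣ.sum-cong-≗ (λ i → ind-cong (u FinP.≟ i) (i FinP.≟ u) sym sym)) (sum-δ₁ u)

  -- Over all ordered pairs the incidences at `i` number 2n, of which the loop at `i` accounts for
  -- 2. Halving the rest gives n - 1.
  degree : ∀ n (i : Fin n) → suc (sum (λ j → inc (edge n j) i)) ≡ n
  degree n i = ℕP.*-cancelˡ-≡ _ _ 2 (sym (begin
    2 * n                                       ≡⟨ cong (n +_) (ℕP.+-identityʳ n) ⟩
    n + n                                       ≡⟨ cong₂ _+_ (n≡ n) (n≡ n) ⟩
    n * 1 + n * 1                               ≡⟨ cong₂ _+_ (rows n) (cols n) ⟩
    sum (λ u → sum (λ (v : Fin n) → δ u i)) + sum (λ (u : Fin n) → sum (λ v → δ v i))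
                                                ≡⟨ sym (ℕΣ.∑-distrib-+ (λ u → sum (λ (v : Fin n) → δ u i)) (λ u → sum (λ v → δ v i))) ⟩
    sum (λ u → sum (λ (v : Fin n) → δ u i) + sum (λ v → δ v i))
                                                ≡⟨ ℕΣ.sum-cong-≗ (λ u → sym (ℕΣ.∑-distrib-+ (λ (v : Fin n) → δ u i) (λ v → δ v i))) ⟩
    sum (λ u → sum (λ v → inc (u , v) i))       ≡⟨ sum-pairs n (λ e → inc e i) (λ u v → ℕP.+-comm (δ u i) (δ v i)) ⟩
    2 * X + sum (λ u → δ u i + δ u i)           ≡⟨ cong (2 * X +_) (ℕΣ.∑-distrib-+ (λ u → δ u i) (λ u → δ u i)) ⟩
    2 * X + (sum (λ u → δ u i) + sum (λ u → δ u i)) ≡⟨ cong (2 * X +_) (cong₂ _+_ (sum-δ₁ i) (sum-δ₁ i)) ⟩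
    2 * X + 2                                   ≡⟨ solve 1 (λ x → con 2 :* x :+ con 2 := con 2 :* (con 1 :+ x)) refl X ⟩
    2 * suc X                                   ∎))
    where
    open ≡-Reasoning
    open +-*-Solver
    X = sum (λ j → inc (edge n j) i)
    n≡ : ∀ m → m ≡ m * 1
    n≡ m = sym (ℕP.*-identityʳ m)
    rows : ∀ m → m * 1 ≡ sum (λ u → sum {m} (λ v → δ u i))
    rows m = sym (trans (ℕΣ.sum-cong-≗ (λ u → sum-const m (δ u i)))
      (trans (sum-scale m (λ u → δ u i)) (cong (m *_) (sum-δ₁ i))))
    cols : ∀ m → m * 1 ≡ sum {m} (λ u → sum (λ v → δ v i))
    cols m = sym (trans (sum-const m _) (cong (m *_) (sum-δ₁ i)))

  -- The Gram identity BᵀB = J + (n - 2) I: two distinct vertices lie on one common edge, a single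
  -- vertex lies on n - 1 edges. The subtraction is moved to the other side.
  codegree : ∀ n (i i′ : Fin n) → sum (λ j → inc (edge n j) i * inc (edge n j) i′) + 2 * δ i i′ ≡ 1 + n * δ i i′
  codegree n i i′ = ℕP.*-cancelˡ-≡ _ _ 2 (sym (begin
    2 * (1 + n * d)                         ≡⟨ solve 2 (λ n d → con 2 :* (con 1 :+ n :* d) := n :* d :+ con 1 :+ (con 1 :+ n :* d)) refl n d ⟩
    n * d + 1 + (1 + n * d)                 ≡⟨ cong₂ _+_ (cong₂ _+_ (sym uu) (sym uv)) (cong₂ _+_ (sym vu) (sym vv)) ⟩
    ΣΣ (λ u v → δ u i * δ u i′) + ΣΣ (λ u v → δ u i * δ v i′) + (ΣΣ (λ u v → δ v i * δ u i′) + ΣΣ (λ u v → δ v i * δ v i′))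
      ≡⟨ cong₂ _+_ (sym (ΣΣ-+ (λ u v → δ u i * δ u i′) (λ u v → δ u i * δ v i′))) (sym (ΣΣ-+ (λ u v → δ v i * δ u i′) (λ u v → δ v i * δ v i′))) ⟩
    ΣΣ (λ u v → δ u i * δ u i′ + δ u i * δ v i′) + ΣΣ (λ u v → δ v i * δ u i′ + δ v i * δ v i′)
      ≡⟨ sym (ΣΣ-+ (λ u v → δ u i * δ u i′ + δ u i * δ v i′) (λ u v → δ v i * δ u i′ + δ v i * δ v i′)) ⟩
    ΣΣ (λ u v → δ u i * δ u i′ + δ u i * δ v i′ + (δ v i * δ u i′ + δ v i * δ v i′))
      ≡⟨ ℕΣ.sum-cong-≗ (λ u → ℕΣ.sum-cong-≗ (λ v → solve 4 (λ a b c e →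
           a :* c :+ a :* e :+ (b :* c :+ b :* e) := (a :+ b) :* (c :+ e)) refl (δ u i) (δ v i) (δ u i′) (δ v i′))) ⟩
    ΣΣ (λ u v → inc (u , v) i * inc (u , v) i′)
      ≡⟨ sum-pairs n (λ e → inc e i * inc e i′) (λ u v → cong₂ _*_ (ℕP.+-comm (δ u i) (δ v i)) (ℕP.+-comm (δ u i′) (δ v i′))) ⟩
    2 * X + sum (λ u → (δ u i + δ u i) * (δ u i′ + δ u i′))
      ≡⟨ cong (2 * X +_) (trans (ℕΣ.sum-cong-≗ (λ u → solve 2 (λ a b → (a :+ a) :* (b :+ b) := con 4 :* (a :* b)) refl (δ u i) (δ u i′)))
           (trans (sum-scale 4 (λ u → δ u i * δ u i′)) (cong (4 *_) (sum-δ i (λ u → δ u i′))))) ⟩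
    2 * X + 4 * d                           ≡⟨ solve 2 (λ x d → con 2 :* x :+ con 4 :* d := con 2 :* (x :+ con 2 :* d)) refl X d ⟩
    2 * (X + 2 * d)                         ∎))
    where
    open ≡-Reasoning
    open +-*-Solver
    d = δ i i′
    X = sum (λ j → inc (edge n j) i * inc (edge n j) i′)
    ΣΣ : (Fin n → Fin n → ℕ) → ℕ
    ΣΣ f = sum (λ u → sum (f u))
    ΣΣ-+ : ∀ f g → ΣΣ (λ u v → f u v + g u v) ≡ ΣΣ f + ΣΣ g
    ΣΣ-+ f g = trans (ℕΣ.sum-cong-≗ (λ u → ℕΣ.∑-distrib-+ (f u) (g u))) (ℕΣ.∑-distrib-+ (λ u → sum (f u)) _)
    vv : ΣΣ (λ u v → δ v i * δ v i′) ≡ n * d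
    vv = trans (sum-const n _) (cong (n *_) (sum-δ i (λ v → δ v i′)))
    uu : ΣΣ (λ u v → δ u i * δ u i′) ≡ n * d
    uu = trans (ℕΣ.∑-comm {n} {n} (λ u v → δ u i * δ u i′)) vv
    uv : ΣΣ (λ u v → δ u i * δ v i′) ≡ 1
    uv = trans (ℕΣ.sum-cong-≗ (λ u → trans (sum-scale (δ u i) (λ v → δ v i′)) (cong (δ u i *_) (sum-δ₁ i′))))
           (sum-δ i (λ _ → 1))
    vu : ΣΣ (λ u v → δ v i * δ u i′) ≡ 1
    vu = trans (ℕΣ.∑-comm (λ u v → δ v i * δ u i′)) uv

  -- Counting sequences of edges

  count : ∀ n → ℕ → (List (Pair n) → ℕ) → ℕ
  count n zero    φ = φ []
  count n (suc k) φ = sum (λ j → count n k (λ s → φ (edge n j ∷ s)))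

  countOrdered : ∀ n → ℕ → (List (Pair n) → ℕ) → ℕ
  countOrdered n zero    φ = φ []
  countOrdered n (suc k) φ = sum (λ u → sum (λ v → countOrdered n k (λ s → φ ((u , v) ∷ s))))

  count-cong : ∀ n k {φ ψ : List (Pair n) → ℕ} → (∀ s → φ s ≡ ψ s) → count n k φ ≡ count n k ψ
  count-cong n zero    eq = eq []
  count-cong n (suc k) eq = ℕΣ.sum-cong-≗ λ j → count-cong n k λ s → eq (edge n j ∷ s)

  count-+ : ∀ n k (φ ψ : List (Pair n) → ℕ) → count n k (λ s → φ s + ψ s) ≡ count n k φ + count n k ψ
  count-+ n zero    φ ψ = refl
  count-+ n (suc k) φ ψ = trans (ℕΣ.sum-cong-≗ λ j → count-+ n k (λ s → φ (edge n j ∷ s)) _)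
    (ℕΣ.∑-distrib-+ (λ j → count n k (λ s → φ (edge n j ∷ s))) _)

  count-0 : ∀ n k → count n k (λ _ → 0) ≡ 0
  count-0 n zero    = refl
  count-0 n (suc k) = trans (ℕΣ.sum-cong-≗ {numEdges n} λ j → count-0 n k) (sum-0 (numEdges n))

  term≤count : ∀ n (s : List (Fin (numEdges n))) (φ : List (Pair n) → ℕ) →
               φ (map (edge n) s) ≤ count n (length s) φ
  term≤count n []      φ = ℕP.≤-refl
  term≤count n (j ∷ s) φ = ℕP.≤-trans (term≤count n s (λ t → φ (edge n j ∷ t)))
    (term≤sum (λ j → count n (length s) (λ t → φ (edge n j ∷ t))) j)

  countOrdered-cong : ∀ n k {φ ψ : List (Pair n) → ℕ} → (∀ s → φ s ≡ ψ s) → countOrdered n k φ ≡ countOrdered n k ψ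
  countOrdered-cong n zero    eq = eq []
  countOrdered-cong n (suc k) eq =
    ℕΣ.sum-cong-≗ λ u → ℕΣ.sum-cong-≗ λ v → countOrdered-cong n k λ s → eq ((u , v) ∷ s)

  countOrdered-0 : ∀ n k {φ : List (Pair n) → ℕ} → (∀ s → φ s ≡ 0) → countOrdered n k φ ≡ 0
  countOrdered-0 n zero    eq = eq []
  countOrdered-0 n (suc k) eq = trans (ℕΣ.sum-cong-≗ λ u → trans
      (ℕΣ.sum-cong-≗ λ v → countOrdered-0 n k λ s → eq ((u , v) ∷ s)) (sum-0 n)) (sum-0 n)

  act : (Fin n → Fin n) → List (Pair n) → List (Pair n)
  act σ = map (λ (u , v) → σ u , σ v)

  countOrdered-perm : ∀ n k (π : Permutation n n) (φ : List (Pair n) → ℕ) →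
                      countOrdered n k (φ ∘ act (π ⟨$⟩ʳ_)) ≡ countOrdered n k φ
  countOrdered-perm n zero    π φ = refl
  countOrdered-perm n (suc k) π φ = begin
    sum (λ u → sum (λ v → countOrdered n k (λ s → φ ((σ u , σ v) ∷ act σ s))))
      ≡⟨ ℕΣ.sum-cong-≗ (λ u → ℕΣ.sum-cong-≗ λ v → countOrdered-perm n k π (λ s → φ ((σ u , σ v) ∷ s))) ⟩
    sum (λ u → sum (λ v → f (σ u) (σ v)))
      ≡⟨ ℕΣ.sum-cong-≗ (λ u → sym (ℕΣ.sum-permute (f (σ u)) π)) ⟩
    sum (λ u → sum (λ v → f (σ u) v))
      ≡⟨ sym (ℕΣ.sum-permute (λ u → sum (f u)) π) ⟩
    sum (λ u → sum (λ v → f u v)) ∎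
    where
    open ≡-Reasoning
    σ = π ⟨$⟩ʳ_
    f : Fin n → Fin n → ℕ
    f u v = countOrdered n k (λ s → φ ((u , v) ∷ s))

  _≃_ : Pair n → Pair n → Set
  e ≃ f = e ≡ f ⊎ e ≡ swap f

  ≃-refl : {e : Pair n} → e ≃ e
  ≃-refl = inj₁ refl

  ≃-sym : {e f : Pair n} → e ≃ f → f ≃ e
  ≃-sym (inj₁ refl) = inj₁ refl
  ≃-sym (inj₂ refl) = inj₂ refl

  -- These two conditions make the ordered count 2^k times the edge count: reversing an edge changes
  -- nothing, and loops contribute nothing.
  record Unoriented {n} (φ : List (Pair n) → ℕ) : Set where
    field
      resp : ∀ {s s′} → Pointwise _≃_ s s′ → φ s ≡ φ s′
      loop : ∀ {s} → Any (λ (u , v) → u ≡ v) s → φ s ≡ 0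

  open Unoriented

  unoriented-∷ : ∀ {φ : List (Pair n) → ℕ} → Unoriented φ → ∀ e → Unoriented (λ s → φ (e ∷ s))
  unoriented-∷ U e .resp p = U .resp (≃-refl ∷ p)
  unoriented-∷ U e .loop p = U .loop (there p)

  count-double : ∀ n k {φ : List (Pair n) → ℕ} → Unoriented φ → countOrdered n k φ ≡ 2 ^ k * count n k φ
  count-double n zero    {φ} U = sym (ℕP.+-identityʳ (φ []))
  count-double n (suc k) {φ} U = begin
    sum (λ u → sum (λ v → f (u , v)))           ≡⟨ sum-pairs n f (λ u v → countOrdered-cong n k λ s → U .resp (inj₂ refl ∷ Pointwise.refl ≃-refl)) ⟩
    2 * sum (f ∘ edge n) + sum (λ u → f (u , u)) ≡⟨ cong₂ _+_ (cong (2 *_) (ℕΣ.sum-cong-≗ λ j → count-double n k (unoriented-∷ U (edge n j))))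
                                                      (trans (ℕΣ.sum-cong-≗ λ u → countOrdered-0 n k λ s → U .loop {(u , u) ∷ s} (here refl)) (sum-0 n)) ⟩
    2 * sum (λ j → 2 ^ k * g j) + 0              ≡⟨ ℕP.+-identityʳ _ ⟩
    2 * sum (λ j → 2 ^ k * g j)                  ≡⟨ cong (2 *_) (sum-scale (2 ^ k) g) ⟩
    2 * (2 ^ k * sum g)                          ≡⟨ sym (ℕP.*-assoc 2 (2 ^ k) (sum g)) ⟩
    2 ^ suc k * sum g                            ∎
    where
    open ≡-Reasoning
    f : Pair n → ℕ
    f e = countOrdered n k (λ s → φ (e ∷ s))
    g = λ j → count n k (λ s → φ (edge n j ∷ s))

  -- Symmetry under vertex permutations

  -- This covers both reversing edges, with `σ` the identity, and relabelling vertices, with `s′`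
  -- the image of `s`. A predicate built from connectivity and forests is thus checked for
  -- invariance only once.
  record Similar {n} (σ : Fin n → Fin n) (s s′ : List (Pair n)) : Set where
    field
      conn⇒   : ∀ {x y} → Conn s x y → Conn s′ (σ x) (σ y)
      conn⇐   : ∀ {x y} → Conn s′ (σ x) (σ y) → Conn s x y
      forest⇒ : Forest s → Forest s′
      forest⇐ : Forest s′ → Forest s

  open Similar

  conn-≃ : ∀ {s s′ : List (Pair n)} → Pointwise _≃_ s s′ → ∀ {x y} → Conn s x y → Conn s′ x y
  conn-≃ [] p = p
  conn-≃ (_ ∷ q) (inj₁ p) = inj₁ (conn-≃ q p)
  conn-≃ (inj₁ refl ∷ q) (inj₂ (inj₁ (a , b))) = inj₂ (inj₁ (conn-≃ q a , conn-≃ q b))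
  conn-≃ (inj₁ refl ∷ q) (inj₂ (inj₂ (a , b))) = inj₂ (inj₂ (conn-≃ q a , conn-≃ q b))
  conn-≃ (inj₂ refl ∷ q) (inj₂ (inj₁ (a , b))) = inj₂ (inj₂ (conn-≃ q a , conn-≃ q b))
  conn-≃ (inj₂ refl ∷ q) (inj₂ (inj₂ (a , b))) = inj₂ (inj₁ (conn-≃ q a , conn-≃ q b))

  ≃-flip : ∀ {s s′ : List (Pair n)} → Pointwise _≃_ s s′ → Pointwise _≃_ s′ s
  ≃-flip = Pointwise.symmetric ≃-sym

  forest-≃ : ∀ {s s′ : List (Pair n)} → Pointwise _≃_ s s′ → Forest s → Forest s′
  forest-≃ [] F = F
  forest-≃ (inj₁ refl ∷ q) (F , ¬e) = forest-≃ q F , ¬e ∘ conn-≃ (≃-flip q)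
  forest-≃ {s′ = _ ∷ s′} (inj₂ refl ∷ q) (F , ¬e) = forest-≃ q F , ¬e ∘ conn-≃ (≃-flip q) ∘ conn-sym s′

  ≃-similar : ∀ {s s′ : List (Pair n)} → Pointwise _≃_ s s′ → Similar id s s′
  ≃-similar q .conn⇒   = conn-≃ q
  ≃-similar q .conn⇐   = conn-≃ (≃-flip q)
  ≃-similar q .forest⇒ = forest-≃ q
  ≃-similar q .forest⇐ = forest-≃ (≃-flip q)

  act-similar : ∀ (σ : Fin n → Fin n) → (∀ {x y} → σ x ≡ σ y → x ≡ y) → ∀ s → Similar σ s (act σ s)
  act-similar σ inj [] .conn⇒ = cong σ
  act-similar σ inj [] .conn⇐ = inj
  act-similar σ inj [] .forest⇒ _ = tt
  act-similar σ inj [] .forest⇐ _ = tt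
  act-similar σ inj (e ∷ s) with act-similar σ inj s
  ... | S = λ where
    .conn⇒ (inj₁ p) → inj₁ (S .conn⇒ p)
    .conn⇒ (inj₂ (inj₁ (p , q))) → inj₂ (inj₁ (S .conn⇒ p , S .conn⇒ q))
    .conn⇒ (inj₂ (inj₂ (p , q))) → inj₂ (inj₂ (S .conn⇒ p , S .conn⇒ q))
    .conn⇐ (inj₁ p) → inj₁ (S .conn⇐ p)
    .conn⇐ (inj₂ (inj₁ (p , q))) → inj₂ (inj₁ (S .conn⇐ p , S .conn⇐ q))
    .conn⇐ (inj₂ (inj₂ (p , q))) → inj₂ (inj₂ (S .conn⇐ p , S .conn⇐ q))
    .forest⇒ (F , ¬e) → S .forest⇒ F , ¬e ∘ S .conn⇐
    .forest⇐ (F , ¬e) → S .forest⇐ F , ¬e ∘ S .conn⇒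

  loop-¬forest : ∀ {s : List (Pair n)} → Any (λ (u , v) → u ≡ v) s → ¬ Forest s
  loop-¬forest {s = _ ∷ s} (here refl) (_ , ¬e) = ¬e (conn-refl s)
  loop-¬forest (there i) (F , _) = loop-¬forest i F

  perm-injective : (π : Permutation n n) → ∀ {x y} → π ⟨$⟩ʳ x ≡ π ⟨$⟩ʳ y → x ≡ y
  perm-injective π eq = trans (sym (Perm.inverseˡ π)) (trans (cong (π ⟨$⟩ˡ_) eq) (Perm.inverseˡ π))

  transpose-hit : (i j : Fin n) → PC.transpose i j i ≡ j
  transpose-hit i j rewrite dec-true (i FinP.≟ i) refl = refl

  transpose-miss : {i j k : Fin n} → k ≢ i → k ≢ j → PC.transpose i j k ≡ k
  transpose-miss {i = i} {j} {k} k≢i k≢j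
    rewrite dec-false (k FinP.≟ i) k≢i | dec-false (k FinP.≟ j) k≢j = refl

  -- After the tails are matched, a transposition moves the image of `x` to `y`. It fixes the points
  -- already placed, since they differ from `y` and, by injectivity, from the image of `x`.
  permute-to : (xs ys : List (Fin n)) → length xs ≡ length ys → Unique xs → Unique ys →
               ∃[ π ] map (Perm._⟨$⟩ʳ_ {n} {n} π) xs ≡ ys
  permute-to [] [] _ _ _ = Perm.id , refl
  permute-to (x ∷ xs) (y ∷ ys) len (x∉ ∷ U) (y∉ ∷ V) with permute-to xs ys (ℕP.suc-injective len) U V
  ... | π , refl = π ∘ₚ Perm.transpose πx y , cong₂ _∷_ (transpose-hit πx y) (fixes xs x∉ y∉)
    where
    πx = π ⟨$⟩ʳ x
    fixes : ∀ zs → All (x ≢_) zs → All (y ≢_) (map (π ⟨$⟩ʳ_) zs) →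
            map (λ z → PC.transpose πx y (π ⟨$⟩ʳ z)) zs ≡ map (π ⟨$⟩ʳ_) zs
    fixes []       _        _        = refl
    fixes (z ∷ zs) (x≢ ∷ a) (y≢ ∷ b) =
      cong₂ _∷_ (transpose-miss (x≢ ∘ sym ∘ perm-injective π) (y≢ ∘ sym)) (fixes zs a b)

  module SymmetricCount {n : ℕ}
    (Q : Fin n → Fin n → Fin n → Fin n → List (Pair n) → Set)
    (Q? : ∀ w x y z s → Dec (Q w x y z s))
    (Q⇒forest : ∀ {w x y z s} → Q w x y z s → Forest s)
    (Q⇒ : ∀ {σ s s′ w x y z} → Similar σ s s′ → Q w x y z s → Q (σ w) (σ x) (σ y) (σ z) s′)
    (Q⇐ : ∀ {σ s s′ w x y z} → Similar σ s s′ → Q (σ w) (σ x) (σ y) (σ z) s′ → Q w x y z s)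
    where

    unoriented : ∀ w x y z → Unoriented (λ s → ind (Q? w x y z s))
    unoriented w x y z .resp p = ind-cong (Q? w x y z _) (Q? w x y z _) (Q⇒ (≃-similar p)) (Q⇐ (≃-similar p))
    unoriented w x y z .loop p = ind-no (Q? w x y z _) (loop-¬forest p ∘ Q⇒forest)

    total : ℕ → Fin n → Fin n → Fin n → Fin n → ℕ
    total k w x y z = count n k (λ s → ind (Q? w x y z s))

    -- Both sides are multiplied by 2^k to pass to ordered pairs, where the permutation acts; the
    -- factor is then cancelled.
    total-perm : ∀ k (π : Permutation n n) w x y z →
                 total k (π ⟨$⟩ʳ w) (π ⟨$⟩ʳ x) (π ⟨$⟩ʳ y) (π ⟨$⟩ʳ z) ≡ total k w x y z
    total-perm k π w x y z = ℕP.*-cancelˡ-≡ _ _ (2 ^ k) {{ℕP.m^n≢0 2 k}} (begin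
      2 ^ k * total k (σ w) (σ x) (σ y) (σ z)                    ≡⟨ sym (count-double n k (unoriented (σ w) (σ x) (σ y) (σ z))) ⟩
      countOrdered n k (λ s → ind (Q? (σ w) (σ x) (σ y) (σ z) s)) ≡⟨ sym (countOrdered-perm n k π _) ⟩
      countOrdered n k (λ s → ind (Q? (σ w) (σ x) (σ y) (σ z) (act σ s)))
        ≡⟨ countOrdered-cong n k (λ s → ind-cong (Q? (σ w) (σ x) (σ y) (σ z) (act σ s)) (Q? w x y z s)
             (Q⇐ (act-similar σ (perm-injective π) s)) (Q⇒ (act-similar σ (perm-injective π) s))) ⟩
      countOrdered n k (λ s → ind (Q? w x y z s))                ≡⟨ count-double n k (unoriented w x y z) ⟩
      2 ^ k * total k w x y z                                    ∎)
      where
      open ≡-Reasoning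
      σ = π ⟨$⟩ʳ_

    total-unique : ∀ k {w x y z w′ x′ y′ z′} → Unique (w ∷ x ∷ y ∷ z ∷ []) → Unique (w′ ∷ x′ ∷ y′ ∷ z′ ∷ []) →
                   total k w x y z ≡ total k w′ x′ y′ z′
    total-unique k {w} {x} {y} {z} {w′} {x′} {y′} {z′} U V
      with permute-to (w ∷ x ∷ y ∷ z ∷ []) (w′ ∷ x′ ∷ y′ ∷ z′ ∷ []) refl U V
    ... | π , refl = sym (total-perm k π w x y z)

  -- Classification of forests by four marked vertices

  Apart : Fin n → Fin n → Fin n → Fin n → List (Pair n) → Set
  Apart w x y z s = Forest s × ¬ Conn s w x × ¬ Conn s w y × ¬ Conn s w z × ¬ Conn s x y × ¬ Conn s x z × ¬ Conn s y z

  -- The first two vertices are the joined pair. Separations are listed for `x` only, because those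
  -- for `w` follow from the connection.
  Merged : Fin n → Fin n → Fin n → Fin n → List (Pair n) → Set
  Merged w x y z s = Forest s × Conn s w x × ¬ Conn s x y × ¬ Conn s x z × ¬ Conn s y z

  apart? : (w x y z : Fin n) (s : List (Pair n)) → Dec (Apart w x y z s)
  apart? w x y z s = forest? s ×-dec ¬? (conn? s w x) ×-dec ¬? (conn? s w y) ×-dec ¬? (conn? s w z)
    ×-dec ¬? (conn? s x y) ×-dec ¬? (conn? s x z) ×-dec ¬? (conn? s y z)

  merged? : (w x y z : Fin n) (s : List (Pair n)) → Dec (Merged w x y z s)
  merged? w x y z s = forest? s ×-dec conn? s w x ×-dec ¬? (conn? s x y) ×-dec ¬? (conn? s x z) ×-dec ¬? (conn? s y z)

  module ApartCount {n} = SymmetricCount {n} Apart apart? proj₁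
    (λ S (F , a , b , c , d , e , f) → S .forest⇒ F ,
      a ∘ S .conn⇐ , b ∘ S .conn⇐ , c ∘ S .conn⇐ , d ∘ S .conn⇐ , e ∘ S .conn⇐ , f ∘ S .conn⇐)
    (λ S (F , a , b , c , d , e , f) → S .forest⇐ F ,
      a ∘ S .conn⇒ , b ∘ S .conn⇒ , c ∘ S .conn⇒ , d ∘ S .conn⇒ , e ∘ S .conn⇒ , f ∘ S .conn⇒)

  module MergedCount {n} = SymmetricCount {n} Merged merged? proj₁
    (λ S (F , a , b , c , d) → S .forest⇒ F , S .conn⇒ a , b ∘ S .conn⇐ , c ∘ S .conn⇐ , d ∘ S .conn⇐)
    (λ S (F , a , b , c , d) → S .forest⇐ F , S .conn⇐ a , b ∘ S .conn⇒ , c ∘ S .conn⇒ , d ∘ S .conn⇒)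

  private
    +-cong₄ : ∀ {a b c d a′ b′ c′ d′ : ℕ} → a ≡ a′ → b ≡ b′ → c ≡ c′ → d ≡ d′ → a + (b + (c + d)) ≡ a′ + (b′ + (c′ + d′))
    +-cong₄ refl refl refl refl = refl

  module _ {n : ℕ} (s : List (Pair n)) where

    private
      _~_ : Fin n → Fin n → Set
      x ~ y = Conn s x y
      ~sym : ∀ {x y} → x ~ y → y ~ x
      ~sym = conn-sym s
      ~trans : ∀ {x y z} → x ~ y → y ~ z → x ~ z
      ~trans = conn-trans s

    forest-adjacent : ∀ {x y z} → Forest s → ¬ x ~ y → ¬ x ~ z → ¬ y ~ z → Forest ((x , y) ∷ (x , z) ∷ s)
    forest-adjacent F xy xz yz = (F , xz) , λ where
      (inj₁ p)              → xy p
      (inj₂ (inj₁ (_ , p))) → yz (~sym p)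
      (inj₂ (inj₂ (p , _))) → xz p

    adjacent-forest : ∀ {x y z} → Forest ((x , y) ∷ (x , z) ∷ s) → Forest s × ¬ x ~ y × ¬ x ~ z × ¬ y ~ z
    adjacent-forest ((F , xz) , ¬xy) =
      F , ¬xy ∘ inj₁ , xz , λ p → ¬xy (inj₂ (inj₁ (conn-refl s , ~sym p)))

    -- The two edges force `x`, `y`, `z` into three different components, and `w` lies in none of
    -- these or in exactly one. The edges do not involve `w`; it is there to express the count by
    -- the same quantities as for disjoint edges.
    adjacent-split : ∀ w x y z →
      ind (forest? ((x , y) ∷ (x , z) ∷ s)) ≡
      ind (apart? w x y z s) + (ind (merged? w x y z s) + (ind (merged? w y x z s) + ind (merged? w z x y s)))
    adjacent-split w x y z with forest? ((x , y) ∷ (x , z) ∷ s)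
    ... | no ¬F = sym (+-cong₄
      (ind-no (apart? w x y z s) λ (F , _ , _ , _ , xy , xz , yz) → ¬F (forest-adjacent F xy xz yz))
      (ind-no (merged? w x y z s) λ (F , _ , xy , xz , yz) → ¬F (forest-adjacent F xy xz yz))
      (ind-no (merged? w y x z s) λ (F , _ , yx , yz , xz) → ¬F (forest-adjacent F (yx ∘ ~sym) xz yz))
      (ind-no (merged? w z x y s) λ (F , _ , zx , zy , xy) → ¬F (forest-adjacent F xy (zx ∘ ~sym) (zy ∘ ~sym))))
    ... | yes F′ with adjacent-forest F′
    ... | F , xy , xz , yz = cases (conn? s w x) (conn? s w y) (conn? s w z)
      where
      cases : Dec (w ~ x) → Dec (w ~ y) → Dec (w ~ z) →
        1 ≡ ind (apart? w x y z s) + (ind (merged? w x y z s) + (ind (merged? w y x z s) + ind (merged? w z x y s)))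
      cases (yes wx) _ _ = sym (+-cong₄
        (ind-no (apart? w x y z s) λ (_ , ¬wx , _) → ¬wx wx)
        (ind-yes (merged? w x y z s) (F , wx , xy , xz , yz))
        (ind-no (merged? w y x z s) λ (_ , wy , _) → xy (~trans (~sym wx) wy))
        (ind-no (merged? w z x y s) λ (_ , wz , _) → xz (~trans (~sym wx) wz)))
      cases (no ¬wx) (yes wy) _ = sym (+-cong₄
        (ind-no (apart? w x y z s) λ (_ , _ , ¬wy , _) → ¬wy wy)
        (ind-no (merged? w x y z s) λ (_ , wx , _) → ¬wx wx)
        (ind-yes (merged? w y x z s) (F , wy , xy ∘ ~sym , yz , xz))
        (ind-no (merged? w z x y s) λ (_ , wz , _) → yz (~trans (~sym wy) wz)))
      cases (no ¬wx) (no ¬wy) (yes wz) = sym (+-cong₄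
        (ind-no (apart? w x y z s) λ (_ , _ , _ , ¬wz , _) → ¬wz wz)
        (ind-no (merged? w x y z s) λ (_ , wx , _) → ¬wx wx)
        (ind-no (merged? w y x z s) λ (_ , wy , _) → ¬wy wy)
        (ind-yes (merged? w z x y s) (F , wz , xz ∘ ~sym , yz ∘ ~sym , xy)))
      cases (no ¬wx) (no ¬wy) (no ¬wz) = sym (+-cong₄
        (ind-yes (apart? w x y z s) (F , ¬wx , ¬wy , ¬wz , xy , xz , yz))
        (ind-no (merged? w x y z s) λ (_ , wx , _) → ¬wx wx)
        (ind-no (merged? w y x z s) λ (_ , wy , _) → ¬wy wy)
        (ind-no (merged? w z x y s) λ (_ , wz , _) → ¬wz wz))

    forest-disjoint : ∀ {w x y z} → Forest s → ¬ w ~ x → ¬ y ~ z → ¬ (w ~ y × z ~ x) → ¬ (w ~ z × y ~ x) →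
                      Forest ((w , x) ∷ (y , z) ∷ s)
    forest-disjoint F wx yz a b = (F , yz) , λ where
      (inj₁ p)        → wx p
      (inj₂ (inj₁ p)) → a p
      (inj₂ (inj₂ p)) → b p

    -- At most one of the four cross connections between the two edges can hold: two that share a
    -- vertex would connect the endpoints of one edge, and two that do not would close a cycle
    -- through both edges.
    disjoint-split : ∀ w x y z →
      ind (forest? ((w , x) ∷ (y , z) ∷ s)) ≡
      ind (apart? w x y z s) + ((ind (merged? w y x z s) + ind (merged? w z x y s)) +
                                (ind (merged? x y w z s) + ind (merged? x z w y s)))
    disjoint-split w x y z with forest? ((w , x) ∷ (y , z) ∷ s)
    ... | no ¬F = sym (cong₂ _+_
      (ind-no (apart? w x y z s) λ (F , wx , wy , wz , xy , xz , yz) → ¬F (forest-disjoint F wx yz (wy ∘ proj₁) (wz ∘ proj₁)))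
      (cong₂ _+_ (cong₂ _+_
        (ind-no (merged? w y x z s) λ (F , wy , yx , yz , xz) → ¬F (forest-disjoint F
          (λ p → yx (~trans (~sym wy) p)) yz (xz ∘ ~sym ∘ proj₂) (yx ∘ proj₂)))
        (ind-no (merged? w z x y s) λ (F , wz , zx , zy , xy) → ¬F (forest-disjoint F
          (λ p → zx (~trans (~sym wz) p)) (zy ∘ ~sym) (zx ∘ proj₂) (xy ∘ ~sym ∘ proj₂))))
       (cong₂ _+_
        (ind-no (merged? x y w z s) λ (F , xy , yw , yz , wz) → ¬F (forest-disjoint F
          (λ p → yw (~sym (~trans p xy))) yz (yw ∘ ~sym ∘ proj₁) (wz ∘ proj₁)))
        (ind-no (merged? x z w y s) λ (F , xz , zw , zy , wy) → ¬F (forest-disjoint F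
          (λ p → zw (~sym (~trans p xz))) (zy ∘ ~sym) (wy ∘ proj₁) (zw ∘ ~sym ∘ proj₁))))))
    ... | yes ((F , yz) , ¬wx) = cases (conn? s w y) (conn? s w z) (conn? s x y) (conn? s x z)
      where
      wx : ¬ w ~ x
      wx = ¬wx ∘ inj₁
      a : ¬ (w ~ y × z ~ x)
      a = ¬wx ∘ inj₂ ∘ inj₁
      b : ¬ (w ~ z × y ~ x)
      b = ¬wx ∘ inj₂ ∘ inj₂
      cases : Dec (w ~ y) → Dec (w ~ z) → Dec (x ~ y) → Dec (x ~ z) →
        1 ≡ ind (apart? w x y z s) + ((ind (merged? w y x z s) + ind (merged? w z x y s)) +
                                      (ind (merged? x y w z s) + ind (merged? x z w y s)))
      cases (yes wy) _ _ _ = sym (cong₂ _+_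
        (ind-no (apart? w x y z s) λ (_ , _ , ¬wy , _) → ¬wy wy)
        (cong₂ _+_ (cong₂ _+_
          (ind-yes (merged? w y x z s) (F , wy , (λ p → wx (~trans wy p)) , yz , λ p → a (wy , ~sym p)))
          (ind-no (merged? w z x y s) λ (_ , wz , _) → yz (~trans (~sym wy) wz)))
         (cong₂ _+_
          (ind-no (merged? x y w z s) λ (_ , _ , yw , _) → yw (~sym wy))
          (ind-no (merged? x z w y s) λ (_ , _ , _ , _ , ¬wy) → ¬wy wy))))
      cases (no ¬wy) (yes wz) _ _ = sym (cong₂ _+_
        (ind-no (apart? w x y z s) λ (_ , _ , _ , ¬wz , _) → ¬wz wz)
        (cong₂ _+_ (cong₂ _+_
          (ind-no (merged? w y x z s) λ (_ , wy , _) → ¬wy wy)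
          (ind-yes (merged? w z x y s) (F , wz , (λ p → wx (~trans wz p)) , yz ∘ ~sym , λ p → b (wz , ~sym p))))
         (cong₂ _+_
          (ind-no (merged? x y w z s) λ (_ , _ , _ , _ , ¬wz) → ¬wz wz)
          (ind-no (merged? x z w y s) λ (_ , _ , zw , _) → zw (~sym wz)))))
      cases (no ¬wy) (no ¬wz) (yes xy) _ = sym (cong₂ _+_
        (ind-no (apart? w x y z s) λ (_ , _ , _ , _ , ¬xy , _) → ¬xy xy)
        (cong₂ _+_ (cong₂ _+_
          (ind-no (merged? w y x z s) λ (_ , wy , _) → ¬wy wy)
          (ind-no (merged? w z x y s) λ (_ , wz , _) → ¬wz wz))
         (cong₂ _+_
          (ind-yes (merged? x y w z s) (F , xy , (λ p → ¬wy (~sym p)) , yz , ¬wz))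
          (ind-no (merged? x z w y s) λ (_ , xz , _) → yz (~trans (~sym xy) xz)))))
      cases (no ¬wy) (no ¬wz) (no ¬xy) (yes xz) = sym (cong₂ _+_
        (ind-no (apart? w x y z s) λ (_ , _ , _ , _ , _ , ¬xz , _) → ¬xz xz)
        (cong₂ _+_ (cong₂ _+_
          (ind-no (merged? w y x z s) λ (_ , wy , _) → ¬wy wy)
          (ind-no (merged? w z x y s) λ (_ , wz , _) → ¬wz wz))
         (cong₂ _+_
          (ind-no (merged? x y w z s) λ (_ , xy , _) → ¬xy xy)
          (ind-yes (merged? x z w y s) (F , xz , (λ p → ¬wz (~sym p)) , yz ∘ ~sym , ¬wy)))))
      cases (no ¬wy) (no ¬wz) (no ¬xy) (no ¬xz) = sym (cong₂ _+_
        (ind-yes (apart? w x y z s) (F , wx , ¬wy , ¬wz , ¬xy , ¬xz , yz))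
        (cong₂ _+_ (cong₂ _+_
          (ind-no (merged? w y x z s) λ (_ , wy , _) → ¬wy wy)
          (ind-no (merged? w z x y s) λ (_ , wz , _) → ¬wz wz))
         (cong₂ _+_
          (ind-no (merged? x y w z s) λ (_ , xy , _) → ¬xy xy)
          (ind-no (merged? x z w y s) λ (_ , xz , _) → ¬xz xz))))

  -- Pigeonhole: if every vertex occurred in `xs`, its position there would inject the vertices into
  -- a smaller set.
  fresh : (xs : List (Fin n)) → length xs < n → ∃[ w ] All (w ≢_) xs
  fresh {n} xs len with FinP.any? (λ w → All.all? (λ x → ¬? (w FinP.≟ x)) xs)
  ... | yes p = p
  ... | no ¬p = contradiction (FinP.injective⇒≤ {f = index} index-injective) (ℕP.<⇒≱ len)
    where
    member : ∀ w → w ∈ xs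
    member w = decidable-stable (Any.any? (w FinP.≟_) xs) λ w∉ → ¬p (w , go xs w∉)
      where
      go : ∀ ys → w ∉ ys → All (w ≢_) ys
      go []       _  = []
      go (y ∷ ys) w∉ = (λ p → w∉ (here p)) ∷ go ys (w∉ ∘ there)
    index : Fin n → Fin (length xs)
    index w = Any.index (member w)
    index-injective : ∀ {v w} → index v ≡ index w → v ≡ w
    index-injective {v} {w} = ∈SP.index-injective (setoid (Fin n)) (member v) (member w)

  -- The witness is a star centred at vertex 0.
  forest-star : ∀ n k → 2 + k < n → ∃[ x ] ∃[ y ] ∃[ z ] ∃[ s ]
    (x ≢ y × x ≢ z × y ≢ z × length s ≡ k × Forest ((x , y) ∷ (x , z) ∷ map (edge n) s))
  forest-star (suc n′) k (s≤s 2+k≤n′) =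
    zero , leaf 2+k≤n′ , leaf 1+k≤n′ , star k k≤n′ , (λ ()) , (λ ()) ,
    (λ eq → ℕP.1+n≢n (trans (sym (leaf-toℕ 2+k≤n′)) (trans (cong Fin.toℕ eq) (leaf-toℕ 1+k≤n′)))) ,
    star-length k k≤n′ ,
    subst (λ s → Forest ((zero , leaf 2+k≤n′) ∷ (zero , leaf 1+k≤n′) ∷ s)) (sym (star-edges k k≤n′)) (pairs-forest (2 + k) 2+k≤n′)
    where
    1+k≤n′ = ℕP.<⇒≤ 2+k≤n′
    k≤n′   = ℕP.<⇒≤ 1+k≤n′
    leaf : ∀ {i} → i < n′ → Fin (suc n′)
    leaf i<n′ = suc (Fin.fromℕ< i<n′)
    leaf-toℕ : ∀ {i} (i<n′ : i < n′) → Fin.toℕ (leaf i<n′) ≡ suc i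
    leaf-toℕ i<n′ = cong suc (FinP.toℕ-fromℕ< i<n′)
    pairs : ∀ i → i ≤ n′ → List (Pair (suc n′))
    pairs zero    _    = []
    pairs (suc i) i<n′ = (zero , leaf i<n′) ∷ pairs i (ℕP.<⇒≤ i<n′)
    -- The leaf for `i` has number `suc i`, so `pairs i` touches only the vertices 0 to `i`. A later
    -- vertex is a component by itself, and so the next spoke closes no cycle.
    isolated : ∀ i (i≤n′ : i ≤ n′) {x y} → Conn (pairs i i≤n′) x y → i < Fin.toℕ x → x ≡ y
    isolated zero    _    p        _   = p
    isolated (suc i) i<n′ (inj₁ p) i<x = isolated i _ p (ℕP.<⇒≤ i<x)
    isolated (suc i) i<n′ (inj₂ (inj₁ (p , _))) i<x with isolated i _ p (ℕP.<⇒≤ i<x)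
    ... | refl = contradiction i<x λ ()
    isolated (suc i) i<n′ (inj₂ (inj₂ (p , _))) i<x with isolated i _ p (ℕP.<⇒≤ i<x)
    ... | refl = contradiction (sym (leaf-toℕ i<n′)) (ℕP.<⇒≢ i<x)
    pairs-forest : ∀ i i≤n′ → Forest (pairs i i≤n′)
    pairs-forest zero    _    = tt
    pairs-forest (suc i) i<n′ = pairs-forest i _ , λ p → contradiction
      (isolated i _ (conn-sym (pairs i (ℕP.<⇒≤ i<n′)) p) (ℕP.≤-reflexive (sym (leaf-toℕ i<n′)))) λ ()
    spoke : ∀ {i} (i<n′ : i < n′) → (zero , leaf i<n′) ∈ edgesK (suc n′)
    spoke i<n′ = ∈P.∈-filter⁺ (λ p → proj₁ p Fin.<? proj₂ p)
      (∈P.∈-cartesianProduct⁺ (∈P.∈-allFin zero) (∈P.∈-allFin (leaf i<n′))) (s≤s z≤n)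
    star : ∀ i → i ≤ n′ → List (Fin (numEdges (suc n′)))
    star zero    _    = []
    star (suc i) i<n′ = Any.index (spoke i<n′) ∷ star i (ℕP.<⇒≤ i<n′)
    star-edges : ∀ i i≤n′ → map (edge (suc n′)) (star i i≤n′) ≡ pairs i i≤n′
    star-edges zero    _    = refl
    star-edges (suc i) i<n′ = cong₂ _∷_ (sym (AnyP.lookup-index (spoke i<n′))) (star-edges i _)
    star-length : ∀ i i≤n′ → length (star i i≤n′) ≡ i
    star-length zero    _    = refl
    star-length (suc i) i<n′ = cong suc (star-length i _)

  -- Entries of the matrix in terms of the two counts

  common : Pair n → Pair n → ℕ
  common e (u , v) = inc e u + inc e v

  module ForestCounts (n k : ℕ) (3<n : 3 < n) (w₀ x₀ y₀ z₀ : Fin n) (base : Unique (w₀ ∷ x₀ ∷ y₀ ∷ z₀ ∷ [])) where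

    apart merged : ℕ
    apart  = ApartCount.total k w₀ x₀ y₀ z₀
    merged = MergedCount.total k w₀ x₀ y₀ z₀

    pairCount : Pair n → Pair n → ℕ
    pairCount e f = count n k (λ s → ind (forest? (e ∷ f ∷ s)))

    pairCount-≃ : ∀ {e e′ f f′} → e ≃ e′ → f ≃ f′ → pairCount e f ≡ pairCount e′ f′
    pairCount-≃ {e} {e′} {f} {f′} p q = count-cong n k λ s →
      ind-cong (forest? (e ∷ f ∷ s)) (forest? (e′ ∷ f′ ∷ s))
        (forest-≃ (p ∷ q ∷ Pointwise.refl ≃-refl)) (forest-≃ (≃-sym p ∷ ≃-sym q ∷ Pointwise.refl ≃-refl))

    pairCount-diagonal : ∀ e → pairCount e e ≡ 0
    pairCount-diagonal e = trans
      (count-cong n k λ s → ind-no (forest? (e ∷ e ∷ s)) λ (_ , ¬e) → ¬e (conn-edge {s = e ∷ s} (here refl)))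
      (count-0 n k)

    pairCount-adjacent : ∀ {x y z} → x ≢ y → x ≢ z → y ≢ z → pairCount (x , y) (x , z) ≡ apart + 3 * merged
    pairCount-adjacent {x} {y} {z} xy xz yz with fresh (x ∷ y ∷ z ∷ []) 3<n
    ... | w , wx ∷ wy ∷ wz ∷ [] = begin
      pairCount (x , y) (x , z)                ≡⟨ count-cong n k (λ s → adjacent-split s w x y z) ⟩
      count n k (λ s → A s + (B s + (C s + D s))) ≡⟨ count-+ n k A _ ⟩
      count n k A + count n k (λ s → B s + (C s + D s)) ≡⟨ cong (count n k A +_) (trans (count-+ n k B _) (cong (count n k B +_) (count-+ n k C D))) ⟩
      count n k A + (count n k B + (count n k C + count n k D))
        ≡⟨ +-cong₄ (ApartCount.total-unique k ((wx ∷ wy ∷ wz ∷ []) ∷ (xy ∷ xz ∷ []) ∷ (yz ∷ []) ∷ [] ∷ []) base)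
                (MergedCount.total-unique k ((wx ∷ wy ∷ wz ∷ []) ∷ (xy ∷ xz ∷ []) ∷ (yz ∷ []) ∷ [] ∷ []) base)
                (MergedCount.total-unique k ((wy ∷ wx ∷ wz ∷ []) ∷ (xy ∘ sym ∷ yz ∷ []) ∷ (xz ∷ []) ∷ [] ∷ []) base)
                (MergedCount.total-unique k ((wz ∷ wx ∷ wy ∷ []) ∷ (xz ∘ sym ∷ yz ∘ sym ∷ []) ∷ (xy ∷ []) ∷ [] ∷ []) base) ⟩
      apart + (merged + (merged + merged))     ≡⟨ solve 2 (λ t p → t :+ (p :+ (p :+ p)) := t :+ con 3 :* p) refl apart merged ⟩
      apart + 3 * merged                       ∎
      where
      open ≡-Reasoning
      open +-*-Solver
      A B C D : List (Pair n) → ℕ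
      A s = ind (apart? w x y z s)
      B s = ind (merged? w x y z s)
      C s = ind (merged? w y x z s)
      D s = ind (merged? w z x y s)

    pairCount-disjoint : ∀ {w x y z} → Unique (w ∷ x ∷ y ∷ z ∷ []) →
                         pairCount (w , x) (y , z) ≡ apart + 4 * merged
    pairCount-disjoint {w} {x} {y} {z} U@((wx ∷ wy ∷ wz ∷ []) ∷ (xy ∷ xz ∷ []) ∷ (yz ∷ []) ∷ [] ∷ []) = begin
      pairCount (w , x) (y , z)                 ≡⟨ count-cong n k (λ s → disjoint-split s w x y z) ⟩
      count n k (λ s → A s + ((B s + C s) + (D s + E s))) ≡⟨ count-+ n k A _ ⟩
      count n k A + count n k (λ s → (B s + C s) + (D s + E s))
        ≡⟨ cong (count n k A +_) (trans (count-+ n k (λ s → B s + C s) _) (cong₂ _+_ (count-+ n k B C) (count-+ n k D E))) ⟩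
      count n k A + ((count n k B + count n k C) + (count n k D + count n k E))
        ≡⟨ cong₂ _+_ (ApartCount.total-unique k U base) (cong₂ _+_
             (cong₂ _+_ (MergedCount.total-unique k ((wy ∷ wx ∷ wz ∷ []) ∷ (xy ∘ sym ∷ yz ∷ []) ∷ (xz ∷ []) ∷ [] ∷ []) base)
                        (MergedCount.total-unique k ((wz ∷ wx ∷ wy ∷ []) ∷ (xz ∘ sym ∷ yz ∘ sym ∷ []) ∷ (xy ∷ []) ∷ [] ∷ []) base))
             (cong₂ _+_ (MergedCount.total-unique k ((xy ∷ wx ∘ sym ∷ xz ∷ []) ∷ (wy ∘ sym ∷ yz ∷ []) ∷ (wz ∷ []) ∷ [] ∷ []) base)
                        (MergedCount.total-unique k ((xz ∷ wx ∘ sym ∷ xy ∷ []) ∷ (wz ∘ sym ∷ yz ∘ sym ∷ []) ∷ (wy ∷ []) ∷ [] ∷ []) base))) ⟩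
      apart + ((merged + merged) + (merged + merged)) ≡⟨ solve 2 (λ t p → t :+ ((p :+ p) :+ (p :+ p)) := t :+ con 4 :* p) refl apart merged ⟩
      apart + 4 * merged                        ∎
      where
      open ≡-Reasoning
      open +-*-Solver
      A B C D E : List (Pair n) → ℕ
      A s = ind (apart? w x y z s)
      B s = ind (merged? w y x z s)
      C s = ind (merged? w z x y s)
      D s = ind (merged? x y w z s)
      E s = ind (merged? x z w y s)

    -- `common` is the entry of B Bᵀ: 2, 1 or 0 for equal, adjacent or disjoint edges. Its
    -- coefficient is the difference between the disjoint and the adjacent count, and the
    -- coefficient of `δ` is then forced by the zero diagonal.
    hessian : ∀ j f → pairCount (edge n j) (edge n f) + merged * common (edge n j) (edge n f)
                      + (apart + 2 * merged) * δ j f ≡ apart + 4 * merged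
    hessian j f = go (edge n j) (edge n f) refl refl
      where
      open +-*-Solver
      combine : ∀ {a b c M I d} → M ≡ a → I ≡ b → d ≡ c → a + merged * b + (apart + 2 * merged) * c ≡ apart + 4 * merged →
                M + merged * I + (apart + 2 * merged) * d ≡ apart + 4 * merged
      combine refl refl refl eq = eq
      one-common : apart + 3 * merged + merged * 1 + (apart + 2 * merged) * 0 ≡ apart + 4 * merged
      one-common = solve 2 (λ t p → t :+ con 3 :* p :+ p :* con 1 :+ (t :+ con 2 :* p) :* con 0 := t :+ con 4 :* p) refl apart merged
      go : ∀ e e′ → edge n j ≡ e → edge n f ≡ e′ →
           pairCount e e′ + merged * common e e′ + (apart + 2 * merged) * δ j f ≡ apart + 4 * merged
      go (a , b) (c , d) p q = cases (a FinP.≟ c) (b FinP.≟ d) (a FinP.≟ d) (b FinP.≟ c)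
        where
        a<b : a Fin.< b
        a<b = subst (λ e → proj₁ e Fin.< proj₂ e) p (edge-< n j)
        c<d : c Fin.< d
        c<d = subst (λ e → proj₁ e Fin.< proj₂ e) q (edge-< n f)
        a≢b : a ≢ b
        a≢b = FinP.<⇒≢ a<b
        c≢d : c ≢ d
        c≢d = FinP.<⇒≢ c<d
        δ-0 : (a , b) ≢ (c , d) → δ j f ≡ 0
        δ-0 e≢ = δ-≢ λ { refl → e≢ (trans (sym p) q) }
        common≡ : ∀ {ac bc ad bd} → δ a c ≡ ac → δ b c ≡ bc → δ a d ≡ ad → δ b d ≡ bd →
                  common (a , b) (c , d) ≡ ac + bc + (ad + bd)
        common≡ refl refl refl refl = refl
        cases : Dec (a ≡ c) → Dec (b ≡ d) → Dec (a ≡ d) → Dec (b ≡ c) →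
           pairCount (a , b) (c , d) + merged * common (a , b) (c , d) + (apart + 2 * merged) * δ j f ≡ apart + 4 * merged
        cases (yes refl) (yes refl) _ _ = combine (pairCount-diagonal (a , b))
          (common≡ (δ-refl a) (δ-≢ (a≢b ∘ sym)) (δ-≢ a≢b) (δ-refl b))
          (trans (cong (δ j) (sym (edge-injective n (trans p (sym q))))) (δ-refl j))
          (solve 2 (λ t p → con 0 :+ p :* con 2 :+ (t :+ con 2 :* p) :* con 1 := t :+ con 4 :* p) refl apart merged)
        cases (yes refl) (no b≢d) _ _ = combine (pairCount-adjacent a≢b c≢d b≢d)
          (common≡ (δ-refl a) (δ-≢ (a≢b ∘ sym)) (δ-≢ c≢d) (δ-≢ b≢d))
          (δ-0 (b≢d ∘ cong proj₂)) one-common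
        -- `pairCount-adjacent` expects the shared vertex first in both edges; reversing an edge
        -- leaves the count unchanged.
        cases (no a≢c) (yes refl) _ _ = combine
          (trans (pairCount-≃ (inj₂ refl) (inj₂ refl)) (pairCount-adjacent (a≢b ∘ sym) (c≢d ∘ sym) a≢c))
          (common≡ (δ-≢ a≢c) (δ-≢ (c≢d ∘ sym)) (δ-≢ a≢b) (δ-refl b))
          (δ-0 (a≢c ∘ cong proj₁)) one-common
        cases (no a≢c) (no b≢d) (yes refl) (yes refl) = contradiction a<b (FinP.<-asym c<d)
        cases (no a≢c) (no b≢d) (yes refl) (no b≢c) = combine
          (trans (pairCount-≃ (inj₁ refl) (inj₂ refl)) (pairCount-adjacent a≢b a≢c b≢c))
          (common≡ (δ-≢ a≢c) (δ-≢ b≢c) (δ-refl a) (δ-≢ b≢d))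
          (δ-0 (a≢c ∘ cong proj₁)) one-common
        cases (no a≢c) (no b≢d) (no a≢d) (yes refl) = combine
          (trans (pairCount-≃ (inj₂ refl) (inj₁ refl)) (pairCount-adjacent (a≢b ∘ sym) b≢d a≢d))
          (common≡ (δ-≢ a≢c) (δ-refl b) (δ-≢ a≢d) (δ-≢ b≢d))
          (δ-0 (a≢c ∘ cong proj₁)) one-common
        cases (no a≢c) (no b≢d) (no a≢d) (no b≢c) = combine
          (pairCount-disjoint ((a≢b ∷ a≢c ∷ a≢d ∷ []) ∷ (b≢c ∷ b≢d ∷ []) ∷ (c≢d ∷ []) ∷ [] ∷ []))
          (common≡ (δ-≢ a≢c) (δ-≢ b≢c) (δ-≢ a≢d) (δ-≢ b≢d))
          (δ-0 (a≢c ∘ cong proj₁))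
          (solve 2 (λ t p → t :+ con 4 :* p :+ p :* con 0 :+ (t :+ con 2 :* p) :* con 0 := t :+ con 4 :* p) refl apart merged)

    some-forest : 2 + k < n → 0 < apart + 3 * merged
    some-forest 2+k<n with forest-star n k 2+k<n
    ... | x , y , z , s , xy , xz , yz , refl , F = subst (0 <_) (pairCount-adjacent xy xz yz)
      (ℕP.≤-trans (ℕP.≤-reflexive (sym (ind-yes (forest? ((x , y) ∷ (x , z) ∷ map (edge n) s)) F)))
        (term≤count n s (λ t → ind (forest? ((x , y) ∷ (x , z) ∷ t)))))

open CompleteGraph

-- The algebra spanned by J, B Bᵀ and the identity for an incidence matrix B

module IncidenceAlgebra {c ℓ : Level} (R : CommutativeRing c ℓ) where
  open CommutativeRing R
  open import Algebra.Properties.Semiring.Sum semiring as ∑ using (sum)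
  open import Algebra.Solver.Ring.NaturalCoefficients.Default commutativeSemiring using (solve; con; _:+_; _:*_; _:=_)
  open import Relation.Binary.Reasoning.Setoid setoid

  sum-*ˡ : ∀ {n} x (f : Fin n → Carrier) → sum (λ i → x * f i) ≈ x * sum f
  sum-*ˡ x f = sym (∑.*-distribˡ-sum x f)

  sum-*ʳ : ∀ {n} x (f : Fin n → Carrier) → sum (λ i → f i * x) ≈ sum f * x
  sum-*ʳ x f = sym (∑.*-distribʳ-sum x f)

  module Operators {N n : ℕ} (B : Fin N → Fin n → Carrier) (δ : Fin n → Fin n → Carrier) (ρ d ν : Carrier)
    (δ-sum : ∀ i (f : Fin n → Carrier) → sum (λ i′ → δ i i′ * f i′) ≈ f i)
    (rows : ∀ e → sum (B e) ≈ ρ)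
    (cols : ∀ i → sum (λ e → B e i) ≈ d)
    (gram : ∀ i i′ → sum (λ e → B e i * B e i′) ≈ 1# + ν * δ i i′)
    where

    size : Carrier
    size = sum {N} (λ _ → 1#)

    D : (Fin N → Carrier) → Fin n → Carrier
    D v i = sum (λ e → B e i * v e)

    T : (Fin N → Carrier) → Fin N → Carrier
    T v e = sum (λ i → B e i * D v i)

    -- The operator xJ + y B Bᵀ + zI applied to `v`; here `D` is Bᵀ, `T` is B Bᵀ, and J sends `v` to
    -- the constant vector with value `sum v`.
    op : Carrier → Carrier → Carrier → (Fin N → Carrier) → Fin N → Carrier
    op x y z v e = x * sum v + (y * T v e + z * v e)

    T-cong : ∀ {v w} → (∀ e → v e ≈ w e) → ∀ e → T v e ≈ T w e
    T-cong v≈w e = ∑.sum-cong-≋ {n} λ i → *-congˡ (∑.sum-cong-≋ {N} λ e → *-congˡ (v≈w e))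

    op-cong : ∀ {x y z v w} → (∀ e → v e ≈ w e) → ∀ e → op x y z v e ≈ op x y z w e
    op-cong v≈w e = +-cong (*-congˡ (∑.sum-cong-≋ v≈w)) (+-cong (*-congˡ (T-cong v≈w e)) (*-congˡ (v≈w e)))

    T-+ : ∀ v w e → T (λ e → v e + w e) e ≈ T v e + T w e
    T-+ v w e = begin
      sum (λ i → B e i * D (λ e → v e + w e) i)
        ≈⟨ ∑.sum-cong-≋ (λ i → *-congˡ {B e i} (trans (∑.sum-cong-≋ λ e → distribˡ (B e i) (v e) (w e)) (∑.∑-distrib-+ (λ e → B e i * v e) _))) ⟩
      sum (λ i → B e i * (D v i + D w i)) ≈⟨ ∑.sum-cong-≋ (λ i → distribˡ (B e i) (D v i) (D w i)) ⟩
      sum (λ i → B e i * D v i + B e i * D w i) ≈⟨ ∑.∑-distrib-+ (λ i → B e i * D v i) _ ⟩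
      T v e + T w e ∎

    T-* : ∀ x v e → T (λ e → x * v e) e ≈ x * T v e
    T-* x v e = begin
      sum (λ i → B e i * D (λ e → x * v e) i)
        ≈⟨ ∑.sum-cong-≋ (λ i → *-congˡ {B e i} (trans (∑.sum-cong-≋ λ e → solve 3 (λ b x v → b :* (x :* v) := x :* (b :* v)) refl (B e i) x (v e)) (sum-*ˡ x (λ e → B e i * v e)))) ⟩
      sum (λ i → B e i * (x * D v i))
        ≈⟨ ∑.sum-cong-≋ (λ i → solve 3 (λ b x v → b :* (x :* v) := x :* (b :* v)) refl (B e i) x (D v i)) ⟩
      sum (λ i → x * (B e i * D v i)) ≈⟨ sum-*ˡ x (λ i → B e i * D v i) ⟩
      x * T v e ∎

    T-const : ∀ x e → T (λ _ → x) e ≈ x * (ρ * d)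
    T-const x e = begin
      sum (λ i → B e i * sum (λ e → B e i * x)) ≈⟨ ∑.sum-cong-≋ (λ i → *-congˡ (trans (sum-*ʳ x (λ e → B e i)) (*-congʳ (cols i)))) ⟩
      sum (λ i → B e i * (d * x))               ≈⟨ sum-*ʳ (d * x) (B e) ⟩
      sum (B e) * (d * x)                       ≈⟨ *-congʳ (rows e) ⟩
      ρ * (d * x)                               ≈⟨ solve 3 (λ r d x → r :* (d :* x) := x :* (r :* d)) refl ρ d x ⟩
      x * (ρ * d)                               ∎

    D-sum : ∀ v → sum (D v) ≈ ρ * sum v
    D-sum v = begin
      sum (λ i → sum (λ e → B e i * v e)) ≈⟨ ∑.∑-comm (λ i e → B e i * v e) ⟩
      sum (λ e → sum (λ i → B e i * v e)) ≈⟨ ∑.sum-cong-≋ (λ e → trans (sum-*ʳ (v e) (B e)) (*-congʳ (rows e))) ⟩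
      sum (λ e → ρ * v e)                 ≈⟨ sum-*ˡ ρ v ⟩
      ρ * sum v                           ∎

    T-sum : ∀ v → sum (T v) ≈ (ρ * d) * sum v
    T-sum v = begin
      sum (λ e → sum (λ i → B e i * D v i)) ≈⟨ ∑.∑-comm (λ e i → B e i * D v i) ⟩
      sum (λ i → sum (λ e → B e i * D v i)) ≈⟨ ∑.sum-cong-≋ (λ i → trans (sum-*ʳ (D v i) (λ e → B e i)) (*-congʳ (cols i))) ⟩
      sum (λ i → d * D v i)                 ≈⟨ sum-*ˡ d (D v) ⟩
      d * sum (D v)                         ≈⟨ *-congˡ (D-sum v) ⟩
      d * (ρ * sum v)                       ≈⟨ solve 3 (λ d r s → d :* (r :* s) := (r :* d) :* s) refl d ρ (sum v) ⟩
      (ρ * d) * sum v                       ∎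

    D-T : ∀ v i → D (T v) i ≈ ρ * sum v + ν * D v i
    D-T v i = begin
      sum (λ e → B e i * sum (λ i′ → B e i′ * D v i′))
        ≈⟨ ∑.sum-cong-≋ (λ e → trans (sym (sum-*ˡ (B e i) (λ i′ → B e i′ * D v i′))) (∑.sum-cong-≋ λ i′ → sym (*-assoc (B e i) (B e i′) (D v i′)))) ⟩
      sum (λ e → sum (λ i′ → B e i * B e i′ * D v i′)) ≈⟨ ∑.∑-comm (λ e i′ → B e i * B e i′ * D v i′) ⟩
      sum (λ i′ → sum (λ e → B e i * B e i′ * D v i′))
        ≈⟨ ∑.sum-cong-≋ (λ i′ → trans (sum-*ʳ (D v i′) (λ e → B e i * B e i′)) (*-congʳ (gram i i′))) ⟩
      sum (λ i′ → (1# + ν * δ i i′) * D v i′)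
        ≈⟨ ∑.sum-cong-≋ (λ i′ → solve 3 (λ n d v → (con 1 :+ n :* d) :* v := v :+ n :* (d :* v)) refl ν (δ i i′) (D v i′)) ⟩
      sum (λ i′ → D v i′ + ν * (δ i i′ * D v i′)) ≈⟨ ∑.∑-distrib-+ (D v) _ ⟩
      sum (D v) + sum (λ i′ → ν * (δ i i′ * D v i′))
        ≈⟨ +-cong (D-sum v) (trans (sum-*ˡ ν (λ i′ → δ i i′ * D v i′)) (*-congˡ (δ-sum i (D v)))) ⟩
      ρ * sum v + ν * D v i ∎

    -- By the Gram identity, B(BᵀB)Bᵀ is BJBᵀ + ν B Bᵀ, and constant row sums turn BJBᵀ into ρ²J.
    -- This closes the span under multiplication.
    T-T : ∀ v e → T (T v) e ≈ (ρ * ρ) * sum v + ν * T v e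
    T-T v e = begin
      sum (λ i → B e i * D (T v) i) ≈⟨ ∑.sum-cong-≋ (λ i → *-congˡ (D-T v i)) ⟩
      sum (λ i → B e i * (ρ * sum v + ν * D v i))
        ≈⟨ ∑.sum-cong-≋ (λ i → solve 4 (λ b s n v → b :* (s :+ n :* v) := b :* s :+ n :* (b :* v)) refl (B e i) (ρ * sum v) ν (D v i)) ⟩
      sum (λ i → B e i * (ρ * sum v) + ν * (B e i * D v i)) ≈⟨ ∑.∑-distrib-+ (λ i → B e i * (ρ * sum v)) _ ⟩
      sum (λ i → B e i * (ρ * sum v)) + sum (λ i → ν * (B e i * D v i))
        ≈⟨ +-cong (trans (sum-*ʳ (ρ * sum v) (B e)) (*-congʳ (rows e))) (sum-*ˡ ν (λ i → B e i * D v i)) ⟩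
      ρ * (ρ * sum v) + ν * T v e ≈⟨ +-congʳ (sym (*-assoc ρ ρ (sum v))) ⟩
      (ρ * ρ) * sum v + ν * T v e ∎

    sum-op : ∀ x y z v → sum (op x y z v) ≈ (x * size + y * (ρ * d) + z) * sum v
    sum-op x y z v = begin
      sum (op x y z v) ≈⟨ ∑.∑-distrib-+ {N} (λ _ → x * sum v) _ ⟩
      sum {N} (λ _ → x * sum v) + sum (λ e → y * T v e + z * v e)
        ≈⟨ +-cong (trans (∑.sum-cong-≋ {N} λ _ → sym (*-identityʳ (x * sum v))) (sum-*ˡ {N} (x * sum v) (λ _ → 1#)))
                  (trans (∑.∑-distrib-+ (λ e → y * T v e) _) (+-cong (trans (sum-*ˡ y (T v)) (*-congˡ (T-sum v))) (sum-*ˡ z v))) ⟩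
      x * sum v * size + (y * ((ρ * d) * sum v) + z * sum v)
        ≈⟨ solve 6 (λ x y z k m s → x :* s :* m :+ (y :* (k :* s) :+ z :* s) := (x :* m :+ y :* k :+ z) :* s) refl x y z (ρ * d) size (sum v) ⟩
      (x * size + y * (ρ * d) + z) * sum v ∎

    T-op : ∀ x y z v e → T (op x y z v) e ≈ (x * (ρ * d) + y * (ρ * ρ)) * sum v + (y * ν + z) * T v e
    T-op x y z v e = begin
      T (op x y z v) e ≈⟨ T-+ (λ _ → x * sum v) _ e ⟩
      T (λ _ → x * sum v) e + T (λ e → y * T v e + z * v e) e
        ≈⟨ +-cong (T-const (x * sum v) e) (trans (T-+ (λ e → y * T v e) _ e)
             (+-cong (trans (T-* y (T v) e) (*-congˡ (T-T v e))) (T-* z v e))) ⟩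
      x * sum v * (ρ * d) + (y * ((ρ * ρ) * sum v + ν * T v e) + z * T v e)
        ≈⟨ solve 8 (λ x y z k l n s t → x :* s :* k :+ (y :* (l :* s :+ n :* t) :+ z :* t) :=
             (x :* k :+ y :* l) :* s :+ (y :* n :+ z) :* t) refl x y z (ρ * d) (ρ * ρ) ν (sum v) (T v e) ⟩
      (x * (ρ * d) + y * (ρ * ρ)) * sum v + (y * ν + z) * T v e ∎

    op-op : ∀ x y z x′ y′ z′ v e → op x y z (op x′ y′ z′ v) e ≈
      op (x * (x′ * size + y′ * (ρ * d) + z′) + (y * (x′ * (ρ * d) + y′ * (ρ * ρ)) + z * x′))
         (y * (y′ * ν + z′) + z * y′) (z * z′) v e
    op-op x y z x′ y′ z′ v e = begin
      op x y z (op x′ y′ z′ v) e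
        ≈⟨ +-cong (*-congˡ (sum-op x′ y′ z′ v)) (+-congʳ (*-congˡ (T-op x′ y′ z′ v e))) ⟩
      x * (a * sum v) + (y * (b * sum v + c′ * T v e) + z * (x′ * sum v + (y′ * T v e + z′ * v e)))
        ≈⟨ solve 12 (λ x y z x′ y′ z′ a b c s t v →
             x :* (a :* s) :+ (y :* (b :* s :+ c :* t) :+ z :* (x′ :* s :+ (y′ :* t :+ z′ :* v))) :=
             (x :* a :+ (y :* b :+ z :* x′)) :* s :+ ((y :* c :+ z :* y′) :* t :+ (z :* z′) :* v))
             refl x y z x′ y′ z′ a b c′ (sum v) (T v e) (v e) ⟩
      _ ∎
      where
      a  = x′ * size + y′ * (ρ * d) + z′
      b  = x′ * (ρ * d) + y′ * (ρ * ρ)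
      c′ = y′ * ν + z′

    -- The coefficients of J, B Bᵀ and I in the product computed by `op-op`, set equal to those of
    -- the identity.
    record Inverse (x y z x′ y′ z′ : Carrier) : Set ℓ where
      field
        onJ : x * (x′ * size + y′ * (ρ * d) + z′) + (y * (x′ * (ρ * d) + y′ * (ρ * ρ)) + z * x′) ≈ 0#
        onT : y * (y′ * ν + z′) + z * y′ ≈ 0#
        onI : z * z′ ≈ 1#

    op-inverse : ∀ {x y z x′ y′ z′} → Inverse x y z x′ y′ z′ → ∀ v e → op x y z (op x′ y′ z′ v) e ≈ v e
    op-inverse {x} {y} {z} {x′} {y′} {z′} I v e = begin
      op x y z (op x′ y′ z′ v) e ≈⟨ op-op x y z x′ y′ z′ v e ⟩
      _ ≈⟨ +-cong (trans (*-congʳ onJ) (zeroˡ (sum v))) (+-cong (trans (*-congʳ onT) (zeroˡ (T v e))) (trans (*-congʳ onI) (*-identityˡ (v e)))) ⟩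
      0# + (0# + v e) ≈⟨ trans (+-identityˡ _) (+-identityˡ _) ⟩
      v e ∎
      where open Inverse I

    -- The algebra is commutative, so a right inverse is also a left inverse. Surjectivity uses the
    -- one and injectivity the other.
    inverse-sym : ∀ {x y z x′ y′ z′} → Inverse x y z x′ y′ z′ → Inverse x′ y′ z′ x y z
    inverse-sym {x} {y} {z} {x′} {y′} {z′} I = record
      { onJ = trans (solve 9 (λ x y z x′ y′ z′ m k l →
                 x′ :* (x :* m :+ y :* k :+ z) :+ (y′ :* (x :* k :+ y :* l) :+ z′ :* x) :=
                 x :* (x′ :* m :+ y′ :* k :+ z′) :+ (y :* (x′ :* k :+ y′ :* l) :+ z :* x′))
                 refl x y z x′ y′ z′ size (ρ * d) (ρ * ρ)) onJ
      ; onT = trans (solve 5 (λ y z y′ z′ n → y′ :* (y :* n :+ z) :+ z′ :* y := y :* (y′ :* n :+ z′) :+ z :* y′)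
                 refl y z y′ z′ ν) onT
      ; onI = trans (*-comm z′ z) onI
      }
      where open Inverse I

    -- The equations are triangular: onI determines z′, then onT gives y′ and onJ gives x′.
    triangular-inverse : ∀ {x y z x′ y′ z′} →
      x′ * (x * size + y * (ρ * d) + z) + (x * (y′ * (ρ * d) + z′) + y * (y′ * (ρ * ρ))) ≈ 0# →
      y′ * (y * ν + z) + y * z′ ≈ 0# → z * z′ ≈ 1# → Inverse x y z x′ y′ z′
    triangular-inverse {x} {y} {z} {x′} {y′} {z′} eqJ eqT eqI = record
      { onJ = trans (solve 9 (λ x y z x′ y′ z′ s k l →
                x :* (x′ :* s :+ y′ :* k :+ z′) :+ (y :* (x′ :* k :+ y′ :* l) :+ z :* x′) :=
                x′ :* (x :* s :+ y :* k :+ z) :+ (x :* (y′ :* k :+ z′) :+ y :* (y′ :* l)))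
                refl x y z x′ y′ z′ size (ρ * d) (ρ * ρ)) eqJ
      ; onT = trans (solve 5 (λ y z y′ z′ n → y :* (y′ :* n :+ z′) :+ z :* y′ := y′ :* (y :* n :+ z) :+ y :* z′)
                refl y z y′ z′ ν) eqT
      ; onI = eqI
      }

    op-injective : ∀ {x y z x′ y′ z′} → Inverse x y z x′ y′ z′ → ∀ {v w} →
                   (∀ e → op x y z v e ≈ op x y z w e) → ∀ e → v e ≈ w e
    op-injective {x} {y} {z} {x′} {y′} {z′} I {v} {w} eq e = begin
      v e                        ≈⟨ sym (op-inverse (inverse-sym I) v e) ⟩
      op x′ y′ z′ (op x y z v) e ≈⟨ op-cong eq e ⟩
      op x′ y′ z′ (op x y z w) e ≈⟨ op-inverse (inverse-sym I) w e ⟩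
      w e                        ∎

-- Exponent vectors

infixl 6 _⊞_
_⊞_ : ∀ {N} → Vec ℕ N → Vec ℕ N → Vec ℕ N
_⊞_ = Vec.zipWith ℕ._+_

⊞-comm : ∀ {N} (a b : Vec ℕ N) → a ⊞ b ≡ b ⊞ a
⊞-comm = VecP.zipWith-comm ℕP.+-comm

⊞-assoc : ∀ {N} (a b c : Vec ℕ N) → (a ⊞ b) ⊞ c ≡ a ⊞ (b ⊞ c)
⊞-assoc = VecP.zipWith-assoc ℕP.+-assoc

⊞-identityˡ : ∀ {N} (a : Vec ℕ N) → Vec.replicate N 0 ⊞ a ≡ a
⊞-identityˡ = VecP.zipWith-identityˡ ℕP.+-identityˡ

⊞∸ : ∀ {N} (a e : Vec ℕ N) → Vec.zipWith _∸_ (a ⊞ e) e ≡ a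
⊞∸ Vec.[]      Vec.[]      = ≡.refl
⊞∸ (x Vec.∷ a) (y Vec.∷ e) = ≡.cong₂ Vec._∷_ (ℕP.m+n∸n≡m x y) (⊞∸ a e)

tally-surjective : ∀ {N} (m : Vec ℕ N) → ∃[ s ] tally s ≡ m
tally-surjective Vec.[] = [] , ≡.refl
tally-surjective (x Vec.∷ m) with tally-surjective m
... | s , ≡.refl = pad x , pad-tally x
  where
  pad : ℕ → List (Fin _)
  pad zero    = List.map suc s
  pad (suc x) = zero ∷ pad x
  tally-suc : ∀ {N} (s : List (Fin N)) → tally (List.map suc s) ≡ 0 Vec.∷ tally s
  tally-suc []      = ≡.refl
  tally-suc (j ∷ s) = ≡.cong (unit (suc j) ⊞_) (tally-suc s)
  pad-tally : ∀ x → tally (pad x) ≡ x Vec.∷ tally s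
  pad-tally zero    = tally-suc s
  pad-tally (suc x) = ≡.trans (≡.cong (unit zero ⊞_) (pad-tally x)) (≡.cong (suc x Vec.∷_) (⊞-identityˡ (tally s)))

unit-injective : ∀ {N} {i j : Fin N} → unit i ≡ unit j → i ≡ j
unit-injective {i = i} {j} eq with i FinP.≟ j
... | yes p = p
... | no i≢j = contradiction
  (≡.trans (≡.sym (lookup-unit i)) (≡.trans (≡.cong (λ v → lookup v i) eq) (lookup-unit-≢ i≢j))) λ ()

degree-one : ∀ {N} (e : Vec ℕ N) → Vec.sum e ≡ 1 → ∃[ j ] e ≡ unit j
degree-one e eq with tally-surjective e
... | s , ≡.refl with s | ≡.trans (≡.sym (sum-tally s)) eq
... | j ∷ [] | _ = j , ≡.trans (⊞-comm (unit j) _) (⊞-identityˡ (unit j))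

-- Polynomials as functionals on exponent vectors

module Pairing {c ℓ : Level} (F : Field c ℓ) where
  open Field F hiding (zero)
  open import Algebra.Properties.Semiring.Sum semiring as ∑ using (sum)
  open import Algebra.Properties.Ring ring using (-‿distribˡ-*; -0#≈0#)
  open import Algebra.Properties.AbelianGroup +-abelianGroup using (⁻¹-∙-comm)
  open import Algebra.Solver.Ring.NaturalCoefficients.Default commutativeSemiring using (solve; con; _:+_; _:*_; _:=_)
  open import Relation.Binary.Reasoning.Setoid setoid
  open IncidenceAlgebra commutativeRing using (sum-*ˡ)

  ι : ℕ → Carrier
  ι = fromℕ F

  ι-+ : ∀ a b → ι (a ℕ.+ b) ≈ ι a + ι b
  ι-+ zero    b = sym (+-identityˡ _)
  ι-+ (suc a) b = trans (+-congˡ (ι-+ a b)) (sym (+-assoc _ _ _))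

  ι-* : ∀ a b → ι (a ℕ.* b) ≈ ι a * ι b
  ι-* zero    b = sym (zeroˡ _)
  ι-* (suc a) b = trans (ι-+ b (a ℕ.* b)) (trans (+-congˡ (ι-* a b))
    (solve 2 (λ x y → y :+ x :* y := (con 1 :+ x) :* y) refl (ι a) (ι b)))

  ι-1 : ι 1 ≈ 1#
  ι-1 = +-identityʳ 1#

  ι-cong : ∀ {a b} → a ≡ b → ι a ≈ ι b
  ι-cong eq = reflexive (≡.cong ι eq)

  ι-sum : ∀ {n} (f : Fin n → ℕ) → ι (ℕΣ.sum f) ≈ sum (λ i → ι (f i))
  ι-sum {zero}  f = refl
  ι-sum {suc n} f = trans (ι-+ (f zero) _) (+-congˡ (ι-sum (f ∘ suc)))

  sum-zero : ∀ {n} {f : Fin n → Carrier} → (∀ i → f i ≈ 0#) → sum f ≈ 0#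
  sum-zero {n} f≈0 = trans (∑.sum-cong-≋ f≈0) (∑.sum-replicate-zero n)

  sum-ιδ : ∀ {n} (i : Fin n) (f : Fin n → Carrier) → sum (λ j → ι (δ i j) * f j) ≈ f i
  sum-ιδ {suc n} zero f = begin
    ι 1 * f zero + sum (λ j → ι (δ zero (suc j)) * f (suc j)) ≈⟨ +-cong (trans (*-congʳ ι-1) (*-identityˡ _)) (sum-zero λ j → zeroˡ (f (suc j))) ⟩
    f zero + 0#                                               ≈⟨ +-identityʳ _ ⟩
    f zero                                                    ∎
  sum-ιδ {suc n} (suc i) f = begin
    0# * f zero + sum (λ j → ι (δ (suc i) (suc j)) * f (suc j))
      ≈⟨ +-cong (zeroˡ _) (∑.sum-cong-≋ λ j → *-congʳ {f (suc j)} (ι-cong (ind-cong (suc i FinP.≟ suc j) (i FinP.≟ j) FinP.suc-injective (≡.cong suc)))) ⟩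
    0# + sum (λ j → ι (δ i j) * f (suc j)) ≈⟨ trans (+-identityˡ _) (sum-ιδ i (f ∘ suc)) ⟩
    f (suc i) ∎

  module _ {N : ℕ} where

    -- The functional sending `φ` to the sum of P_e φ(e). It is computed term by term, so formal
    -- sums with repeated monomials need no collecting, and coefficients, products and derivatives
    -- all take this form.
    pair : Poly F N → (Vec ℕ N → Carrier) → Carrier
    pair P φ = List.foldr (λ (c , e) → c * φ e +_) 0# P

    pair-cong : ∀ P {φ ψ : Vec ℕ N → Carrier} → (∀ e → φ e ≈ ψ e) → pair P φ ≈ pair P ψ
    pair-cong []            eq = refl
    pair-cong ((c , e) ∷ P) eq = +-cong (*-congˡ (eq e)) (pair-cong P eq)

    pair-++ : ∀ P Q φ → pair (P ++ Q) φ ≈ pair P φ + pair Q φ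
    pair-++ []      Q φ = sym (+-identityˡ _)
    pair-++ (_ ∷ P) Q φ = trans (+-congˡ (pair-++ P Q φ)) (sym (+-assoc _ _ _))

    pair-neg : ∀ P φ → pair (neg F P) φ ≈ - pair P φ
    pair-neg []            φ = sym -0#≈0#
    pair-neg ((c , e) ∷ P) φ = trans (+-cong (sym (-‿distribˡ-* c (φ e))) (pair-neg P φ)) (⁻¹-∙-comm _ _)

    pair-⊖ : ∀ P Q φ → pair (_⊖_ F P Q) φ ≈ pair P φ - pair Q φ
    pair-⊖ P Q φ = trans (pair-++ P (neg F Q) φ) (+-congˡ (pair-neg Q φ))

    pair-*ˡ : ∀ x P φ → pair P (λ e → x * φ e) ≈ x * pair P φ
    pair-*ˡ x []            φ = sym (zeroʳ x)
    pair-*ˡ x ((c , e) ∷ P) φ = trans (+-congˡ (pair-*ˡ x P φ))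
      (solve 4 (λ x c f s → c :* (x :* f) :+ x :* s := x :* (c :* f :+ s)) refl x c (φ e) (pair P φ))

    -- Covers products (w = 1) and differential operators (w a falling factorial).
    pair-bilinear : ∀ (μ : Carrier × Vec ℕ N → Carrier × Vec ℕ N → Carrier × Vec ℕ N) (w : Vec ℕ N → Vec ℕ N → Carrier)
      (t : Vec ℕ N → Vec ℕ N → Vec ℕ N) → (∀ a e b f → proj₁ (μ (a , e) (b , f)) ≈ a * (b * w e f)) →
      (∀ a e b f → proj₂ (μ (a , e) (b , f)) ≡ t e f) → ∀ P Q φ →
      pair (concatMap (λ s → List.map (μ s) Q) P) φ ≈ pair P (λ e → pair Q (λ f → w e f * φ (t e f)))
    pair-bilinear μ w t μ₁ μ₂ []            Q φ = refl
    pair-bilinear μ w t μ₁ μ₂ ((a , e) ∷ P) Q φ = trans (pair-++ (List.map (μ (a , e)) Q) _ φ)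
      (+-cong (row Q) (pair-bilinear μ w t μ₁ μ₂ P Q φ))
      where
      row : ∀ Q → pair (List.map (μ (a , e)) Q) φ ≈ a * pair Q (λ f → w e f * φ (t e f))
      row []            = sym (zeroʳ a)
      row ((b , f) ∷ Q) = trans
        (+-cong (*-cong (μ₁ a e b f) (reflexive (≡.cong φ (μ₂ a e b f)))) (row Q))
        (solve 5 (λ a b w x s → a :* (b :* w) :* x :+ a :* s := a :* (b :* (w :* x) :+ s)) refl
          a b (w e f) (φ (t e f)) (pair Q (λ f → w e f * φ (t e f))))

    pair-⊛ : ∀ P Q φ → pair (_⊛_ F P Q) φ ≈ pair P (λ e → pair Q (λ f → φ (e ⊞ f)))
    pair-⊛ P Q φ = trans
      (pair-bilinear _ (λ _ _ → 1#) _⊞_ (λ a e b f → *-congˡ (sym (*-identityʳ b))) (λ _ _ _ _ → ≡.refl) P Q φ)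
      (pair-cong P λ e → pair-cong Q λ f → *-identityˡ (φ (e ⊞ f)))

    fall : Vec ℕ N → Vec ℕ N → ℕ
    fall a e = Vec.foldr _ ℕ._*_ 1 (Vec.zipWith (falling F) a e)

    eq? : (e m : Vec ℕ N) → Dec (e ≡ m)
    eq? = VecP.≡-dec ℕ._≟_

    coeff-pair : ∀ P m → coeff F P m ≈ pair P (λ e → ι (ind (eq? e m)))
    coeff-pair []            m = refl
    coeff-pair ((c , e) ∷ P) m with eq? e m
    ... | yes _ = +-cong (sym (trans (*-congˡ ι-1) (*-identityʳ c))) (coeff-pair P m)
    ... | no _  = trans (coeff-pair P m) (sym (trans (+-congʳ (zeroʳ c)) (+-identityˡ _)))

  falling-< : ∀ a k → a ℕ.< k → falling F a k ≡ 0
  falling-< zero    (suc k) _ = ≡.refl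
  falling-< (suc a) (suc k) (ℕ.s≤s a<k) = ≡.trans (≡.cong (suc a ℕ.*_) (falling-< a k a<k)) (ℕP.*-zeroʳ (suc a))

  fall-zero : ∀ {N} (a e : Vec ℕ N) → fall a e ≡ 0 ⊎ Vec.zipWith _∸_ a e ⊞ e ≡ a
  fall-zero Vec.[]      Vec.[]      = inj₂ ≡.refl
  fall-zero (x Vec.∷ a) (y Vec.∷ e) with y ℕ.≤? x | fall-zero a e
  ... | no y≰x  | _         = inj₁ (≡.cong (ℕ._* fall a e) (falling-< x y (ℕP.≰⇒> y≰x)))
  ... | yes _   | inj₁ zero≡ = inj₁ (≡.trans (≡.cong (falling F x y ℕ.*_) zero≡) (ℕP.*-zeroʳ (falling F x y)))
  ... | yes y≤x | inj₂ eq   = inj₂ (≡.cong₂ Vec._∷_ (ℕP.m∸n+n≡m y≤x) eq)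

  fall-one : ∀ {N} (m e : Vec ℕ N) → (∀ j → lookup (m ⊞ e) j ℕ.≤ 1) → fall (m ⊞ e) e ≡ 1
  fall-one Vec.[]      Vec.[]      _  = ≡.refl
  fall-one (x Vec.∷ m) (y Vec.∷ e) ≤1 = ≡.cong₂ ℕ._*_ (go x y (≤1 zero)) (fall-one m e (≤1 ∘ suc))
    where
    go : ∀ x y → x ℕ.+ y ℕ.≤ 1 → falling F (x ℕ.+ y) y ≡ 1
    go x             zero          _ = ≡.refl
    go zero          (suc zero)    _ = ≡.refl
    go zero          (suc (suc y)) (ℕ.s≤s ())
    go (suc zero)    (suc y)       (ℕ.s≤s ())
    go (suc (suc x)) (suc y)       (ℕ.s≤s ())

  -- Truncated subtraction can produce `m` from an `a` other than `m ⊞ e`, but only if `e` exceeds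
  -- `a` somewhere, and there the falling factorial is zero.
  fall-match : ∀ {N} (a e m : Vec ℕ N) →
    fall a e ℕ.* ind (eq? (Vec.zipWith _∸_ a e) m) ≡ fall (m ⊞ e) e ℕ.* ind (eq? a (m ⊞ e))
  fall-match a e m with eq? a (m ⊞ e)
  ... | yes ≡.refl = ≡.cong (fall (m ⊞ e) e ℕ.*_) (ind-yes (eq? (Vec.zipWith _∸_ (m ⊞ e) e) m) (⊞∸ m e))
  ... | no a≢ with fall-zero a e
  ...   | inj₁ zero≡ = ≡.trans (≡.cong (ℕ._* ind (eq? (Vec.zipWith _∸_ a e) m)) zero≡) (≡.sym (ℕP.*-zeroʳ (fall (m ⊞ e) e)))
  ...   | inj₂ eq = ≡.trans (≡.cong (fall a e ℕ.*_) (ind-no (eq? (Vec.zipWith _∸_ a e) m) λ { ≡.refl → a≢ (≡.sym eq) }))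
                      (≡.trans (ℕP.*-zeroʳ (fall a e)) (≡.sym (ℕP.*-zeroʳ (fall (m ⊞ e) e))))

  coeff-applyD : ∀ {N} (P Φ : Poly F N) m →
    coeff F (applyD F P Φ) m ≈ pair P (λ e → ι (fall (m ⊞ e) e) * coeff F Φ (m ⊞ e))
  coeff-applyD P Φ m = begin
    coeff F (applyD F P Φ) m ≈⟨ coeff-pair (applyD F P Φ) m ⟩
    pair (applyD F P Φ) (λ b → ι (ind (eq? b m)))
      ≈⟨ pair-bilinear (dTerm F) (λ e a → ι (fall a e)) (λ e a → Vec.zipWith _∸_ a e)
           (λ a e b f → *-assoc a b _) (λ _ _ _ _ → ≡.refl) P Φ _ ⟩
    pair P (λ e → pair Φ (λ a → ι (fall a e) * ι (ind (eq? (Vec.zipWith _∸_ a e) m))))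
      ≈⟨ pair-cong P (λ e → trans (pair-cong Φ λ a → trans (sym (ι-* (fall a e) _)) (trans (ι-cong (fall-match a e m)) (ι-* (fall (m ⊞ e) e) _)))
           (trans (pair-*ˡ (ι (fall (m ⊞ e) e)) Φ _) (*-congˡ (sym (coeff-pair Φ (m ⊞ e)))))) ⟩
    pair P (λ e → ι (fall (m ⊞ e) e) * coeff F Φ (m ⊞ e)) ∎

  sumSeq : ∀ N → ℕ → (List (Fin N) → Carrier) → Carrier
  sumSeq N zero    ψ = ψ []
  sumSeq N (suc k) ψ = sum (λ j → sumSeq N k (λ s → ψ (j ∷ s)))

  -- The length is handed to the hypothesis because `g-forest` is available only in degree `r`.
  sumSeq-cong : ∀ N k {φ ψ : List (Fin N) → Carrier} → (∀ s → length s ≡ k → φ s ≈ ψ s) → sumSeq N k φ ≈ sumSeq N k ψ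
  sumSeq-cong N zero    eq = eq [] ≡.refl
  sumSeq-cong N (suc k) eq = ∑.sum-cong-≋ λ j → sumSeq-cong N k λ s len → eq (j ∷ s) (≡.cong suc len)

  sumSeq-zero : ∀ N k {φ : List (Fin N) → Carrier} → (∀ s → length s ≡ k → φ s ≈ 0#) → sumSeq N k φ ≈ 0#
  sumSeq-zero N zero    eq = eq [] ≡.refl
  sumSeq-zero N (suc k) eq = sum-zero λ j → sumSeq-zero N k λ s len → eq (j ∷ s) (≡.cong suc len)

  sumSeq-linear : ∀ N k {M} (v : Fin M → Carrier) (ψ : Fin M → List (Fin N) → Carrier) →
    sumSeq N k (λ s → sum (λ j → v j * ψ j s)) ≈ sum (λ j → v j * sumSeq N k (ψ j))
  sumSeq-linear N zero    v ψ = refl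
  sumSeq-linear N (suc k) v ψ = begin
    sum (λ i → sumSeq N k (λ s → sum (λ j → v j * ψ j (i ∷ s))))
      ≈⟨ ∑.sum-cong-≋ (λ i → sumSeq-linear N k v (λ j s → ψ j (i ∷ s))) ⟩
    sum (λ i → sum (λ j → v j * sumSeq N k (λ s → ψ j (i ∷ s))))
      ≈⟨ ∑.∑-comm (λ i j → v j * sumSeq N k (λ s → ψ j (i ∷ s))) ⟩
    sum (λ j → sum (λ i → v j * sumSeq N k (λ s → ψ j (i ∷ s))))
      ≈⟨ ∑.sum-cong-≋ (λ j → sum-*ˡ (v j) (λ i → sumSeq N k (λ s → ψ j (i ∷ s)))) ⟩
    sum (λ j → v j * sumSeq N (suc k) (ψ j)) ∎

  sumSeq-count : ∀ n k (φ : List (Pair n) → ℕ) →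
                 sumSeq (numEdges n) k (λ s → ι (φ (List.map (edge n) s))) ≈ ι (count n k φ)
  sumSeq-count n zero    φ = refl
  sumSeq-count n (suc k) φ = trans (∑.sum-cong-≋ λ j → sumSeq-count n k (λ s → φ (edge n j ∷ s)))
    (sym (ι-sum (λ j → count n k (λ s → φ (edge n j ∷ s)))))

  pair-L : ∀ N (φ : Vec ℕ N → Carrier) → pair (Lform F N) φ ≈ sum (λ j → φ (unit j))
  pair-L N φ = go N id
    where
    go : ∀ M (h : Fin M → Fin N) → pair (concatMap (var F) (List.tabulate h)) φ ≈ sum (λ j → φ (unit (h j)))
    go zero    h = refl
    go (suc M) h = +-cong (*-identityˡ _) (go M (h ∘ suc))

  -- Multinomial coefficients do not appear: they are the numbers of sequences with the same
  -- `tally`.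
  pair-L^ : ∀ N k (φ : Vec ℕ N → Carrier) → pair (_^P_ F (Lform F N) k) φ ≈ sumSeq N k (λ s → φ (tally s))
  pair-L^ N zero    φ = trans (+-identityʳ _) (*-identityˡ _)
  pair-L^ N (suc k) φ = begin
    pair (_^P_ F (Lform F N) (suc k)) φ ≈⟨ pair-⊛ (Lform F N) (_^P_ F (Lform F N) k) φ ⟩
    pair (Lform F N) (λ e → pair (_^P_ F (Lform F N) k) (λ f → φ (e ⊞ f))) ≈⟨ pair-L N _ ⟩
    sum (λ j → pair (_^P_ F (Lform F N) k) (λ f → φ (unit j ⊞ f))) ≈⟨ ∑.sum-cong-≋ (λ j → pair-L^ N k (λ f → φ (unit j ⊞ f))) ⟩
    sumSeq N (suc k) (λ s → φ (tally s)) ∎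

  -- Repeated terms of a formal linear form are collected into its coefficient vector, the
  -- coordinates in which the matrix M acts.
  linear-pair : ∀ {N} (p : Poly F N) → Homogeneous F 1 p → ∀ φ →
                pair p φ ≈ sum (λ j → coeff F p (unit j) * φ (unit j))
  linear-pair [] [] φ = sym (sum-zero λ j → zeroˡ (φ (unit j)))
  linear-pair ((c , e) ∷ p) (deg ∷ hom) φ with degree-one e deg
  ... | i , ≡.refl = sym (begin
    sum (λ j → coeff F ((c , unit i) ∷ p) (unit j) * φ (unit j))
      ≈⟨ ∑.sum-cong-≋ (λ j → *-congʳ {φ (unit j)} (trans (coeff-pair ((c , unit i) ∷ p) (unit j))
           (+-cong (*-congˡ (ι-cong (ind-cong (eq? (unit i) (unit j)) (i FinP.≟ j) unit-injective (≡.cong unit)))) (sym (coeff-pair p (unit j)))))) ⟩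
    sum (λ j → (c * ι (δ i j) + coeff F p (unit j)) * φ (unit j))
      ≈⟨ ∑.sum-cong-≋ (λ j → solve 4 (λ c d v x → (c :* d :+ v) :* x := c :* (d :* x) :+ v :* x) refl c (ι (δ i j)) (coeff F p (unit j)) (φ (unit j))) ⟩
    sum (λ j → c * (ι (δ i j) * φ (unit j)) + coeff F p (unit j) * φ (unit j))
      ≈⟨ ∑.∑-distrib-+ (λ j → c * (ι (δ i j) * φ (unit j))) _ ⟩
    sum (λ j → c * (ι (δ i j) * φ (unit j))) + sum (λ j → coeff F p (unit j) * φ (unit j))
      ≈⟨ +-cong (trans (sum-*ˡ c (λ j → ι (δ i j) * φ (unit j))) (*-congˡ (sum-ιδ i (λ j → φ (unit j))))) (sym (linear-pair p hom φ)) ⟩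
    c * φ (unit i) + pair p φ ∎)

  linearForm : ∀ {N} → (Fin N → Carrier) → Poly F N
  linearForm v = List.tabulate (λ j → v j , unit j)

  linearForm-homogeneous : ∀ {N} (v : Fin N → Carrier) → Homogeneous F 1 (linearForm v)
  linearForm-homogeneous v = AllP.tabulate⁺ sum-unit

  pair-linearForm : ∀ {N} (v : Fin N → Carrier) φ → pair (linearForm v) φ ≈ sum (λ j → v j * φ (unit j))
  pair-linearForm {N} v φ = go N id
    where
    go : ∀ M (h : Fin M → Fin N) → pair (List.tabulate (λ j → v (h j) , unit (h j))) φ ≈ sum (λ j → v (h j) * φ (unit (h j)))
    go zero    h = refl
    go (suc M) h = +-congˡ (go M (h ∘ suc))

-- Size of the complete graph and choice of vertices

numEdges-double : ∀ n → 2 ℕ.* numEdges n ℕ.+ n ≡ n ℕ.* n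
numEdges-double n = ≡.sym (begin
  n ℕ.* n                                       ≡⟨ ≡.cong (n ℕ.*_) (≡.sym (ones n)) ⟩
  n ℕ.* ℕΣ.sum {n} (λ _ → 1)                     ≡⟨ ≡.sym (sum-const n _) ⟩
  ℕΣ.sum {n} (λ u → ℕΣ.sum {n} (λ v → 1))        ≡⟨ sum-pairs n (λ _ → 1) (λ _ _ → ≡.refl) ⟩
  2 ℕ.* ℕΣ.sum {numEdges n} (λ _ → 1) ℕ.+ ℕΣ.sum {n} (λ _ → 1)
                                                ≡⟨ ≡.cong₂ (λ a b → 2 ℕ.* a ℕ.+ b) (ones (numEdges n)) (ones n) ⟩
  2 ℕ.* numEdges n ℕ.+ n                        ∎)
  where
  open ≡.≡-Reasoning
  ones : ∀ a → ℕΣ.sum {a} (λ _ → 1) ≡ a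
  ones a = ≡.trans (sum-const a 1) (ℕP.*-identityʳ a)

-- Because 2N + n = n², the claim amounts to 3n ≤ n². This bound decides the sign of the eigenvalue
-- on constants.
n≤numEdges : ∀ n → 3 ≤ n → n ≤ numEdges n
n≤numEdges n 3≤n = ℕP.*-cancelˡ-≤ 2 (ℕP.+-cancelʳ-≤ n _ _ (begin
  2 ℕ.* n ℕ.+ n          ≡⟨ solve 1 (λ n → con 2 :* n :+ n := con 3 :* n) ≡.refl n ⟩
  3 ℕ.* n                ≤⟨ ℕP.*-monoˡ-≤ n 3≤n ⟩
  n ℕ.* n                ≡⟨ ≡.sym (numEdges-double n) ⟩
  2 ℕ.* numEdges n ℕ.+ n ∎))
  where
  open +-*-Solver
  open ℕP.≤-Reasoning

four-vertices : ∀ {n} → 3 < n → ∃[ w ] ∃[ x ] ∃[ y ] ∃[ z ] Unique {A = Fin n} (w ∷ x ∷ y ∷ z ∷ [])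
four-vertices 3<n with fresh [] (ℕP.≤-trans (s≤s z≤n) 3<n)
... | z , [] with fresh (z ∷ []) (ℕP.≤-trans (s≤s (s≤s z≤n)) 3<n)
... | y , y≢ with fresh (y ∷ z ∷ []) (ℕP.≤-trans (s≤s (s≤s (s≤s z≤n))) 3<n)
... | x , x≢ with fresh (x ∷ y ∷ z ∷ []) 3<n
... | w , w≢ = w , x , y , z , w≢ ∷ x≢ ∷ y≢ ∷ [] ∷ []

module _ {c ℓ : Level} (F : Field c ℓ) where
  open Field F hiding (zero)
  open import Algebra.Properties.Semiring.Sum semiring as ∑ using (sum)
  open import Algebra.Properties.Ring ring using (-‿distribˡ-*)
  open import Algebra.Properties.Group +-group using (inverseˡ-unique; ⁻¹-injective; x∙y⁻¹≈ε⇒x≈y; x≈y⇒x∙y⁻¹≈ε)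
  open import Algebra.Solver.Ring.NaturalCoefficients.Default commutativeSemiring using (solve; con; _:+_; _:*_; _:=_)
  open import Relation.Binary.Reasoning.Setoid setoid
  open IncidenceAlgebra commutativeRing using (sum-*ˡ; module Operators)
  open Pairing F

  affine-root : ∀ a → ¬ a ≈ 0# → ∀ w → ∃[ u ] u * a + w ≈ 0#
  affine-root a a≉0 w with inverse a a≉0
  ... | b , ab≈1 = - (w * b) , (begin
    - (w * b) * a + w     ≈⟨ +-congʳ (sym (-‿distribˡ-* (w * b) a)) ⟩
    - (w * b * a) + w     ≈⟨ +-congʳ (-‿cong (trans (trans (*-assoc w b a) (*-congˡ (trans (*-comm b a) ab≈1))) (*-identityʳ w))) ⟩
    - w + w               ≈⟨ -‿inverseˡ w ⟩
    0#                    ∎)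

  -- The basis polynomial and equality modulo its annihilator

  module Basis (n r : ℕ) (Φ : Poly F (numEdges n)) (basis : IsBasisGenPoly F n r Φ) where

    g : Vec ℕ (numEdges n) → Carrier
    g = coeff F Φ

    g-degree : ∀ m → Vec.sum m ≢ r → g m ≈ 0#
    g-degree m ≢r = proj₂ (basis m) λ (_ , sum≡ , _) → ≢r sum≡

    g-¬forest : ∀ s → ¬ Forest (List.map (edge n) s) → g (tally s) ≈ 0#
    g-¬forest s ¬F = proj₂ (basis (tally s)) λ (≤1 , _ , ¬cycle) → ¬F (basis⇒forest n s ≤1 ¬cycle)

    g-forest : ∀ s → length s ≡ r → g (tally s) ≈ ι (ind (forest? (List.map (edge n) s)))
    g-forest s len with forest? (List.map (edge n) s)
    ... | yes Fs = trans (proj₁ (basis (tally s)) (forest⇒basis n r s len Fs)) (sym ι-1)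
    ... | no ¬Fs = g-¬forest s ¬Fs

    -- The monomials of Φ are squarefree, so differentiating them produces no factors.
    g-fall : ∀ m e → ι (fall (m ⊞ e) e) * g (m ⊞ e) ≈ g (m ⊞ e)
    g-fall m e with tally-surjective (m ⊞ e)
    ... | s , tally≡ with forest? (List.map (edge n) s)
    ...   | yes Fs = trans (*-congʳ (trans (ι-cong (fall-one m e λ j →
                       ≡.subst (λ v → lookup v j ≤ 1) tally≡ (forest-tally-≤1 n s Fs j))) ι-1)) (*-identityˡ _)
    ...   | no ¬Fs = trans (*-congˡ g≈0) (trans (zeroʳ _) (sym g≈0))
      where
      g≈0 : g (m ⊞ e) ≈ 0#
      g≈0 = ≡.subst (λ v → g v ≈ 0#) tally≡ (g-¬forest s ¬Fs)

    -- By `coeff-shift` this is the coefficient of P(∂)Φ at `m`. Equality in the quotient algebra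
    -- becomes equality of these functions.
    shift : Poly F (numEdges n) → Vec ℕ (numEdges n) → Carrier
    shift P m = pair P (λ e → g (m ⊞ e))

    coeff-shift : ∀ P m → coeff F (applyD F P Φ) m ≈ shift P m
    coeff-shift P m = trans (coeff-applyD P Φ m) (pair-cong P (g-fall m))

    ≈⇒shift : ∀ {p q} → _≈[_]_ F p Φ q → ∀ m → shift p m ≈ shift q m
    ≈⇒shift {p} {q} ann m = x∙y⁻¹≈ε⇒x≈y _ _
      (trans (sym (pair-⊖ p q _)) (trans (sym (coeff-shift (_⊖_ F p q) m)) (ann m)))

    shift⇒≈ : ∀ {p q} → (∀ m → shift p m ≈ shift q m) → _≈[_]_ F p Φ q
    shift⇒≈ {p} {q} eq m = trans (coeff-shift (_⊖_ F p q) m)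
      (trans (pair-⊖ p q _) (x≈y⇒x∙y⁻¹≈ε (eq m)))

    -- A homogeneous element of degree `d` is thus determined in the quotient by its values in
    -- degree r - d; for d = r - 1 these are the values at unit vectors.
    shift-degree : ∀ {d} P → Homogeneous F d P → ∀ m → Vec.sum m ℕ.+ d ≢ r → shift P m ≈ 0#
    shift-degree []            []          m ≢r = refl
    shift-degree ((c , e) ∷ P) (deg ∷ hom) m ≢r = trans
      (+-cong (trans (*-congˡ (g-degree (m ⊞ e) λ eq → ≢r (≡.trans (≡.cong (Vec.sum m ℕ.+_) (≡.sym deg)) (≡.trans (≡.sym (sum-+ m e)) eq)))) (zeroʳ c))
              (shift-degree P hom m ≢r)) (+-identityˡ 0#)

  -- Eigenvalues and invertibility of the matrix

  module Spectrum (char0 : CharZero F) (V m t p : ℕ) (M : Fin (numEdges V) → Fin (numEdges V) → ℕ) (V≡4+m : V ≡ 4 ℕ.+ m)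
    (hessian : ∀ j f → M j f ℕ.+ p ℕ.* common (edge V j) (edge V f) ℕ.+ (t ℕ.+ 2 ℕ.* p) ℕ.* δ j f ≡ t ℕ.+ 4 ℕ.* p)
    (positive : 0 < t ℕ.+ 3 ℕ.* p) where

    private module S = +-*-Solver

    N : ℕ
    N = numEdges V

    H : (Fin N → Carrier) → Fin N → Carrier
    H v f = sum (λ j → v j * ι (M j f))

    B : Fin N → Fin V → Carrier
    B e i = ι (inc (edge V e) i)

    rows : ∀ e → sum (B e) ≈ ι 2
    rows e = trans (sym (ι-sum (inc (edge V e)))) (ι-cong (inc-sum (edge V e)))

    cols : ∀ i → sum (λ e → B e i) ≈ ι (3 ℕ.+ m)
    cols i = trans (sym (ι-sum (λ e → inc (edge V e) i))) (ι-cong (ℕP.suc-injective (≡.trans (degree V i) V≡4+m)))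

    gram : ∀ i i′ → sum (λ e → B e i * B e i′) ≈ 1# + ι (2 ℕ.+ m) * ι (δ i i′)
    gram i i′ = begin
      sum (λ e → B e i * B e i′) ≈⟨ ∑.sum-cong-≋ (λ e → sym (ι-* (inc (edge V e) i) (inc (edge V e) i′))) ⟩
      sum (λ e → ι (inc (edge V e) i ℕ.* inc (edge V e) i′)) ≈⟨ sym (ι-sum (λ e → inc (edge V e) i ℕ.* inc (edge V e) i′)) ⟩
      ι (ℕΣ.sum (λ e → inc (edge V e) i ℕ.* inc (edge V e) i′))
        ≈⟨ ι-cong (ℕP.+-cancelʳ-≡ (2 ℕ.* δ i i′) (ℕΣ.sum (λ e → inc (edge V e) i ℕ.* inc (edge V e) i′)) (1 ℕ.+ (2 ℕ.+ m) ℕ.* δ i i′) (≡.trans (≡.trans (codegree V i i′) (≡.cong (λ a → 1 ℕ.+ a ℕ.* δ i i′) V≡4+m))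
             (S.solve 2 (λ m d → S.con 1 S.:+ (S.con 4 S.:+ m) S.:* d S.:= S.con 1 S.:+ (S.con 2 S.:+ m) S.:* d S.:+ S.con 2 S.:* d) ≡.refl m (δ i i′)))) ⟩
      ι (1 ℕ.+ (2 ℕ.+ m) ℕ.* δ i i′) ≈⟨ +-congˡ (ι-* (2 ℕ.+ m) (δ i i′)) ⟩
      1# + ι (2 ℕ.+ m) * ι (δ i i′) ∎

    -- With `V` = 4 + m the row sum is 2, the degree V - 1 is 3 + m and the Gram constant V - 2 is 2
    -- + m, all without subtraction.
    open Operators B (λ i i′ → ι (δ i i′)) (ι 2) (ι (3 ℕ.+ m)) (ι (2 ℕ.+ m)) sum-ιδ rows cols gram

    -- Working with -M leaves `x` as the only coefficient with a negation; `y` and `z` are images of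
    -- natural numbers, so sums of their multiples can be kept from zero by positivity.
    x y z : Carrier
    x = - ι (t ℕ.+ 4 ℕ.* p)
    y = ι p
    z = ι (t ℕ.+ 2 ℕ.* p)

    T-common : ∀ v f → T v f ≈ sum (λ j → ι (common (edge V j) (edge V f)) * v j)
    T-common v f = begin
      sum (λ i → ι (δ f₁ i ℕ.+ δ f₂ i) * D v i)
        ≈⟨ ∑.sum-cong-≋ (λ i → trans (*-congʳ {D v i} (ι-+ (δ f₁ i) (δ f₂ i))) (distribʳ (D v i) (ι (δ f₁ i)) (ι (δ f₂ i)))) ⟩
      sum (λ i → ι (δ f₁ i) * D v i + ι (δ f₂ i) * D v i) ≈⟨ ∑.∑-distrib-+ (λ i → ι (δ f₁ i) * D v i) _ ⟩
      sum (λ i → ι (δ f₁ i) * D v i) + sum (λ i → ι (δ f₂ i) * D v i) ≈⟨ +-cong (sum-ιδ f₁ (D v)) (sum-ιδ f₂ (D v)) ⟩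
      D v f₁ + D v f₂ ≈⟨ sym (∑.∑-distrib-+ (λ j → B j f₁ * v j) (λ j → B j f₂ * v j)) ⟩
      sum (λ j → B j f₁ * v j + B j f₂ * v j)
        ≈⟨ ∑.sum-cong-≋ (λ j → trans (sym (distribʳ (v j) (B j f₁) (B j f₂))) (*-congʳ {v j} (sym (ι-+ (inc (edge V j) f₁) (inc (edge V j) f₂))))) ⟩
      sum (λ j → ι (common (edge V j) (edge V f)) * v j) ∎
      where
      f₁ = proj₁ (edge V f)
      f₂ = proj₂ (edge V f)

    H-relation : ∀ v f → H v f + (y * T v f + z * v f) ≈ ι (t ℕ.+ 4 ℕ.* p) * sum v
    H-relation v f = begin
      H v f + (y * T v f + z * v f)
        ≈⟨ +-congˡ (+-cong (trans (*-congˡ (T-common v f)) (sym (sum-*ˡ y (λ j → ι (common (edge V j) (edge V f)) * v j))))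
                           (trans (*-congˡ (sym (sum-ιδ f v))) (sym (sum-*ˡ z (λ j → ι (δ f j) * v j))))) ⟩
      sum (λ j → v j * ι (M j f)) + (sum (λ j → y * (ι (C j) * v j)) + sum (λ j → z * (ι (δ f j) * v j)))
        ≈⟨ trans (+-congˡ (sym (∑.∑-distrib-+ (λ j → y * (ι (C j) * v j)) _))) (sym (∑.∑-distrib-+ (λ j → v j * ι (M j f)) _)) ⟩
      sum (λ j → v j * ι (M j f) + (y * (ι (C j) * v j) + z * (ι (δ f j) * v j)))
        ≈⟨ ∑.sum-cong-≋ (λ j → begin
             v j * ι (M j f) + (y * (ι (C j) * v j) + z * (ι (δ f j) * v j))
               ≈⟨ solve 6 (λ v M y C z d → v :* M :+ (y :* (C :* v) :+ z :* (d :* v)) := (M :+ y :* C :+ z :* d) :* v) refl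
                    (v j) (ι (M j f)) y (ι (C j)) z (ι (δ f j)) ⟩
             (ι (M j f) + y * ι (C j) + z * ι (δ f j)) * v j
               ≈⟨ *-congʳ {v j} (sym (trans (ι-+ (M j f ℕ.+ p ℕ.* C j) _) (+-cong (trans (ι-+ (M j f) _) (+-congˡ (ι-* p (C j)))) (ι-* (t ℕ.+ 2 ℕ.* p) (δ f j))))) ⟩
             ι (M j f ℕ.+ p ℕ.* C j ℕ.+ (t ℕ.+ 2 ℕ.* p) ℕ.* δ f j) * v j
               ≈⟨ *-congʳ {v j} (ι-cong (≡.trans (≡.cong (λ d → M j f ℕ.+ p ℕ.* C j ℕ.+ (t ℕ.+ 2 ℕ.* p) ℕ.* d)
                    (ind-cong (f FinP.≟ j) (j FinP.≟ f) ≡.sym ≡.sym)) (hessian j f))) ⟩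
             ι (t ℕ.+ 4 ℕ.* p) * v j ∎) ⟩
      sum (λ j → ι (t ℕ.+ 4 ℕ.* p) * v j) ≈⟨ sum-*ˡ (ι (t ℕ.+ 4 ℕ.* p)) v ⟩
      ι (t ℕ.+ 4 ℕ.* p) * sum v ∎
      where
      C : Fin N → ℕ
      C j = common (edge V j) (edge V f)

    op≈-H : ∀ v f → op x y z v f ≈ - H v f
    op≈-H v f = inverseˡ-unique _ _ (begin
      x * sum v + rest + H v f               ≈⟨ trans (+-assoc _ _ _) (+-congˡ (+-comm rest (H v f))) ⟩
      x * sum v + (H v f + rest)             ≈⟨ +-cong (sym (-‿distribˡ-* b (sum v))) (H-relation v f) ⟩
      - (b * sum v) + b * sum v              ≈⟨ -‿inverseˡ (b * sum v) ⟩
      0#                                     ∎)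
      where
      b = ι (t ℕ.+ 4 ℕ.* p)
      rest = y * T v f + z * v f

    ι-nonzero : ∀ {a} → 0 < a → ¬ ι a ≈ 0#
    ι-nonzero {suc a} _ = char0 a

    -- Such a combination is at least t + 3p. All three eigenvalues are reduced to this estimate.
    pos-from : ∀ a b {c} → a ℕ.* t ℕ.+ b ℕ.* p ≡ c → 1 ≤ a → 3 ≤ b → 0 < c
    pos-from a b ≡.refl 1≤a 3≤b = ℕP.≤-trans positive
      (ℕP.+-mono-≤ (ℕP.≤-trans (ℕP.≤-reflexive (≡.sym (ℕP.*-identityˡ t))) (ℕP.*-monoˡ-≤ t 1≤a)) (ℕP.*-monoˡ-≤ p 3≤b))

    -- The eigenvalue on the kernel of Bᵀ. Its coefficient 2 of `p` is too small for `pos-from`, so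
    -- the estimate is made for twice the eigenvalue.
    z≉0 : ¬ z ≈ 0#
    z≉0 = ι-nonzero (ℕP.*-cancelˡ-< 2 0 (t ℕ.+ 2 ℕ.* p) (pos-from 2 4
      (S.solve 2 (λ t p → S.con 2 S.:* t S.:+ S.con 4 S.:* p S.:= S.con 2 S.:* (t S.:+ S.con 2 S.:* p)) ≡.refl t p)
      (s≤s z≤n) (s≤s (s≤s (s≤s z≤n)))))

    -- The eigenvalue on images under B of vectors of sum zero, where B Bᵀ acts as V - 2; it equals
    -- t + Vp.
    μ≉0 : ¬ y * ι (2 ℕ.+ m) + z ≈ 0#
    μ≉0 eq = ι-nonzero (pos-from 1 (4 ℕ.+ m)
        (S.solve 3 (λ t p m → S.con 1 S.:* t S.:+ (S.con 4 S.:+ m) S.:* p S.:= p S.:* (S.con 2 S.:+ m) S.:+ (t S.:+ S.con 2 S.:* p)) ≡.refl t p m)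
        (s≤s z≤n) (s≤s (s≤s (s≤s z≤n))))
      (trans (trans (ι-+ (p ℕ.* (2 ℕ.+ m)) _) (+-congʳ (ι-* p (2 ℕ.+ m)))) eq)

    size≈ : size ≈ ι N
    size≈ = trans (∑.sum-cong-≋ {N} λ _ → sym ι-1) (trans (sym (ι-sum {N} (λ _ → 1)))
      (ι-cong (≡.trans (sum-const N 1) (ℕP.*-identityʳ N))))

    -- These are the positive and the negative part of the eigenvalue on constants. After N is
    -- lowered to V = 4 + m they still differ by (3 + m)t + (8 + 2m)p.
    gap : p ℕ.* (2 ℕ.* (3 ℕ.+ m)) ℕ.+ (t ℕ.+ 2 ℕ.* p) < (t ℕ.+ 4 ℕ.* p) ℕ.* N
    gap = ℕP.<-≤-trans
      (≡.subst (A <_) (S.solve 3 (λ t p m →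
          p S.:* (S.con 2 S.:* (S.con 3 S.:+ m)) S.:+ (t S.:+ S.con 2 S.:* p) S.:+ ((S.con 3 S.:+ m) S.:* t S.:+ (S.con 8 S.:+ S.con 2 S.:* m) S.:* p)
          S.:= (t S.:+ S.con 4 S.:* p) S.:* (S.con 4 S.:+ m)) ≡.refl t p m)
        (ℕP.m<m+n A (pos-from (3 ℕ.+ m) (8 ℕ.+ 2 ℕ.* m) ≡.refl (s≤s z≤n) (s≤s (s≤s (s≤s z≤n))))))
      (ℕP.*-monoʳ-≤ (t ℕ.+ 4 ℕ.* p) (≡.subst (_≤ N) V≡4+m (n≤numEdges V (≡.subst (3 ≤_) (≡.sym V≡4+m) (s≤s (s≤s (s≤s z≤n)))))))
      where A = p ℕ.* (2 ℕ.* (3 ℕ.+ m)) ℕ.+ (t ℕ.+ 2 ℕ.* p)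

    -- The eigenvalue on constants is negative. Adding the positive number `w` that cancels it shows
    -- that, if it vanished, so would the image of `w`, against characteristic zero.
    λ≉0 : ¬ x * size + y * (ι 2 * ι (3 ℕ.+ m)) + z ≈ 0#
    λ≉0 eq = ι-nonzero (ℕP.m<n⇒0<n∸m gap) (begin
      ι w                                 ≈⟨ sym (+-identityˡ (ι w)) ⟩
      0# + ι w                            ≈⟨ +-congʳ (sym eq) ⟩
      x * size + y * (ι 2 * ι (3 ℕ.+ m)) + z + ι w ≈⟨ +-congʳ (+-congʳ (+-cong
          (trans (*-congˡ size≈) (trans (sym (-‿distribˡ-* (ι (t ℕ.+ 4 ℕ.* p)) (ι N))) (-‿cong (sym (ι-* (t ℕ.+ 4 ℕ.* p) N)))))
          (sym (trans (ι-* p (2 ℕ.* (3 ℕ.+ m))) (*-congˡ (ι-* 2 (3 ℕ.+ m))))))) ⟩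
      - ι b + ι A₁ + z + ι w              ≈⟨ solve 4 (λ b a z w → b :+ a :+ z :+ w := b :+ (a :+ z :+ w)) refl (- ι b) (ι A₁) z (ι w) ⟩
      - ι b + (ι A₁ + z + ι w)            ≈⟨ +-congˡ (trans (+-congʳ (sym (ι-+ A₁ _))) (sym (ι-+ A w))) ⟩
      - ι b + ι (A ℕ.+ w)                 ≈⟨ +-congˡ (ι-cong (ℕP.m+[n∸m]≡n (ℕP.<⇒≤ gap))) ⟩
      - ι b + ι b                         ≈⟨ -‿inverseˡ (ι b) ⟩
      0#                                  ∎)
      where
      A₁ = p ℕ.* (2 ℕ.* (3 ℕ.+ m))
      A  = A₁ ℕ.+ (t ℕ.+ 2 ℕ.* p)
      b  = (t ℕ.+ 4 ℕ.* p) ℕ.* N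
      w  = b ∸ A

    op-invertible : ∃[ x′ ] ∃[ y′ ] ∃[ z′ ] Inverse x y z x′ y′ z′
    op-invertible =
      let (z′ , eqI) = inverse z z≉0
          (y′ , eqT) = affine-root (y * ι (2 ℕ.+ m) + z) μ≉0 (y * z′)
          (x′ , eqJ) = affine-root (x * size + y * (ι 2 * ι (3 ℕ.+ m)) + z) λ≉0
                         (x * (y′ * (ι 2 * ι (3 ℕ.+ m)) + z′) + y * (y′ * (ι 2 * ι 2)))
      in x′ , y′ , z′ , triangular-inverse eqJ eqT eqI

    H-injective : ∀ v w → (∀ f → H v f ≈ H w f) → ∀ f → v f ≈ w f
    H-injective v w eq =
      let (_ , _ , _ , I) = op-invertible
      in op-injective I λ e → trans (op≈-H v e) (trans (-‿cong (eq e)) (sym (op≈-H w e)))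

    H-surjective : ∀ (w : Fin N → Carrier) → ∃[ v ] (∀ f → H v f ≈ w f)
    H-surjective w = let (_ , _ , _ , I) = op-invertible in preimage I
      where
      preimage : ∀ {x′ y′ z′} → Inverse x y z x′ y′ z′ → ∃[ v ] (∀ f → H v f ≈ w f)
      preimage {x′} {y′} {z′} I = op x′ y′ z′ (λ e → - w e) , λ f →
        ⁻¹-injective (trans (sym (op≈-H _ f)) (op-inverse I (λ e → - w e) f))

  -- The multiplication map

  module Main (char0 : CharZero F) (V m k : ℕ) (V≡4+m : V ≡ 4 ℕ.+ m) (2+k<V : 2 ℕ.+ k < V)
    (Φ : Poly F (numEdges V)) (basis : IsBasisGenPoly F V (2 ℕ.+ k) Φ) where

    N : ℕ
    N = numEdges V

    3<V : 3 < V
    3<V = ≡.subst (3 <_) (≡.sym V≡4+m) (s≤s (s≤s (s≤s (s≤s z≤n))))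

    private
      vertices = four-vertices 3<V
      w₀ = proj₁ vertices
      x₀ = proj₁ (proj₂ vertices)
      y₀ = proj₁ (proj₂ (proj₂ vertices))
      z₀ = proj₁ (proj₂ (proj₂ (proj₂ vertices)))

    open Basis V (2 ℕ.+ k) Φ basis
    open ForestCounts V k 3<V w₀ x₀ y₀ z₀ (proj₂ (proj₂ (proj₂ (proj₂ vertices))))

    open Spectrum char0 V m apart merged (λ j f → pairCount (edge V j) (edge V f)) V≡4+m hessian (some-forest 2+k<V)
      using (H; H-injective; H-surjective)

    Lᵏ : Poly F N
    Lᵏ = _^P_ F (Lform F N) k

    -- The form `P` enters only through its action as a functional, so the same computation serves a
    -- given linear form and one built from a prescribed vector.
    shift-raise : ∀ P (v : Fin N → Carrier) → (∀ φ → pair P φ ≈ sum (λ j → v j * φ (unit j))) → ∀ a →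
                  shift (_⊛_ F Lᵏ P) a ≈ sum (λ j → v j * sumSeq N k (λ s → g (a ⊞ (tally s ⊞ unit j))))
    shift-raise P v lin a = begin
      shift (_⊛_ F Lᵏ P) a ≈⟨ pair-⊛ Lᵏ P _ ⟩
      pair Lᵏ (λ e → pair P (λ f → g (a ⊞ (e ⊞ f)))) ≈⟨ pair-L^ N k _ ⟩
      sumSeq N k (λ s → pair P (λ f → g (a ⊞ (tally s ⊞ f)))) ≈⟨ sumSeq-cong N k (λ s _ → lin _) ⟩
      sumSeq N k (λ s → sum (λ j → v j * g (a ⊞ (tally s ⊞ unit j)))) ≈⟨ sumSeq-linear N k v _ ⟩
      sum (λ j → v j * sumSeq N k (λ s → g (a ⊞ (tally s ⊞ unit j)))) ∎

    shift-raise-unit : ∀ P (v : Fin N → Carrier) → (∀ φ → pair P φ ≈ sum (λ j → v j * φ (unit j))) → ∀ f →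
                       shift (_⊛_ F Lᵏ P) (unit f) ≈ H v f
    shift-raise-unit P v lin f = trans (shift-raise P v lin (unit f)) (∑.sum-cong-≋ λ j → *-congˡ {v j} (begin
      sumSeq N k (λ s → g (unit f ⊞ (tally s ⊞ unit j))) ≈⟨ sumSeq-cong N k (λ s len →
        trans (reflexive (≡.cong g (rearranged j s))) (g-forest (j ∷ f ∷ s) (≡.cong (2 ℕ.+_) len))) ⟩
      sumSeq N k (λ s → ι (ind (forest? (edge V j ∷ edge V f ∷ List.map (edge V) s))))
        ≈⟨ sumSeq-count V k (λ s → ind (forest? (edge V j ∷ edge V f ∷ s))) ⟩
      ι (pairCount (edge V j) (edge V f)) ∎))
      where
      rearranged : ∀ j s → unit f ⊞ (tally s ⊞ unit j) ≡ tally (j ∷ f ∷ s)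
      rearranged j s = ≡.trans (≡.sym (⊞-assoc (unit f) (tally s) (unit j))) (⊞-comm (tally (f ∷ s)) (unit j))

    shift-raise-degree : ∀ P (v : Fin N → Carrier) → (∀ φ → pair P φ ≈ sum (λ j → v j * φ (unit j))) → ∀ a →
                         Vec.sum a ≢ 1 → shift (_⊛_ F Lᵏ P) a ≈ 0#
    shift-raise-degree P v lin a ≢1 = trans (shift-raise P v lin a) (sum-zero λ j → trans
      (*-congˡ (sumSeq-zero N k λ s len → g-degree _ λ eq → ≢1 (ℕP.+-cancelʳ-≡ (k ℕ.+ 1) (Vec.sum a) 1
        (≡.trans (≡.sym (sum≡ j s len)) (≡.trans eq (≡.cong suc (ℕP.+-comm 1 k)))))))
      (zeroʳ (v j)))
      where
      sum≡ : ∀ j s → length s ≡ k → Vec.sum (a ⊞ (tally s ⊞ unit j)) ≡ Vec.sum a ℕ.+ (k ℕ.+ 1)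
      sum≡ j s len = ≡.trans (sum-+ a _) (≡.cong (Vec.sum a ℕ.+_) (≡.trans (sum-+ (tally s) (unit j))
        (≡.cong₂ ℕ._+_ (≡.trans (sum-tally s) len) (sum-unit j))))

    -- The values at unit vectors already force `P` and `Q` to have equal coefficients in degree
    -- one, which is stronger than equality in the quotient.
    raise-injective : ∀ P Q → Homogeneous F 1 P → Homogeneous F 1 Q →
      _≈[_]_ F (_⊛_ F Lᵏ P) Φ (_⊛_ F Lᵏ Q) → _≈[_]_ F P Φ Q
    raise-injective P Q hP hQ eq = shift⇒≈ {P} {Q} λ a → begin
      shift P a                                       ≈⟨ linear-pair P hP (λ e → g (a ⊞ e)) ⟩
      sum (λ j → coeff F P (unit j) * g (a ⊞ unit j)) ≈⟨ ∑.sum-cong-≋ (λ j → *-congʳ {g (a ⊞ unit j)} (same j)) ⟩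
      sum (λ j → coeff F Q (unit j) * g (a ⊞ unit j)) ≈⟨ sym (linear-pair Q hQ (λ e → g (a ⊞ e))) ⟩
      shift Q a                                       ∎
      where
      same : ∀ j → coeff F P (unit j) ≈ coeff F Q (unit j)
      same = H-injective (λ j → coeff F P (unit j)) (λ j → coeff F Q (unit j)) λ f → begin
        H (λ j → coeff F P (unit j)) f  ≈⟨ sym (shift-raise-unit P (λ j → coeff F P (unit j)) (linear-pair P hP) f) ⟩
        shift (_⊛_ F Lᵏ P) (unit f)     ≈⟨ ≈⇒shift {_⊛_ F Lᵏ P} {_⊛_ F Lᵏ Q} eq (unit f) ⟩
        shift (_⊛_ F Lᵏ Q) (unit f)     ≈⟨ shift-raise-unit Q (λ j → coeff F Q (unit j)) (linear-pair Q hQ) f ⟩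
        H (λ j → coeff F Q (unit j)) f  ∎

    -- Outside degree one both shifts vanish, so only the N values at unit vectors have to be
    -- matched, and the matrix takes any prescribed values there.
    raise-surjective : ∀ Q → Homogeneous F (1 ℕ.+ k) Q → ∃[ P ] (Homogeneous F 1 P × _≈[_]_ F (_⊛_ F Lᵏ P) Φ Q)
    raise-surjective Q hQ = let (v , Hv) = H-surjective (λ f → shift Q (unit f)) in
      linearForm v , linearForm-homogeneous v , shift⇒≈ {_⊛_ F Lᵏ (linearForm v)} {Q} (agree v Hv)
      where
      agree : ∀ v → (∀ f → H v f ≈ shift Q (unit f)) → ∀ a → shift (_⊛_ F Lᵏ (linearForm v)) a ≈ shift Q a
      agree v Hv a with Vec.sum a ℕ.≟ 1
      ... | no ≢1 = trans (shift-raise-degree (linearForm v) v (pair-linearForm v) a ≢1)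
                      (sym (shift-degree {1 ℕ.+ k} Q hQ a λ eq → ≢1 (ℕP.+-cancelʳ-≡ (1 ℕ.+ k) (Vec.sum a) 1 eq)))
      ... | yes ≡1 with degree-one a ≡1
      ...   | f , ≡.refl = trans (shift-raise-unit (linearForm v) v (pair-linearForm v) f) (Hv f)

theorem3p7 : {c ℓ : Level} (F : Field c ℓ) → CharZero F →
    (n r : ℕ) → 0 < n → 2 < r → r < n →
    (Φ : Poly F (numEdges n)) → IsBasisGenPoly F n r Φ →
    ((p q : Poly F (numEdges n)) → Homogeneous F 1 p → Homogeneous F 1 q →
    _≈[_]_ F (_⊛_ F (_^P_ F (Lform F (numEdges n)) (r ∸ 2)) p) Φ
    (_⊛_ F (_^P_ F (Lform F (numEdges n)) (r ∸ 2)) q) →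
    _≈[_]_ F p Φ q)
    ×
    ((Q : Poly F (numEdges n)) → Homogeneous F (r ∸ 1) Q →
    ∃[ p ] (Homogeneous F 1 p ×
    _≈[_]_ F (_⊛_ F (_^P_ F (Lform F (numEdges n)) (r ∸ 2)) p) Φ Q))
theorem3p7 F char0 n (suc (suc (suc k))) _ (s≤s (s≤s (s≤s _))) r<n Φ basis =
  raise-injective , raise-surjective
  where
  -- Here r - 2 is `suc k`, so the single hypothesis r < n gives both 2 + (r - 2) < n and, since r
  -- is at least 3, the four vertices that make n - 4 an honest difference.
  open Main F char0 n (n ∸ 4) (suc k)
    (≡.sym (ℕP.m+[n∸m]≡n (ℕP.≤-trans (s≤s (s≤s (s≤s (s≤s z≤n)))) r<n))) r<n Φ basis
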